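{- Let $n\ge 2$ and let $\Lambda = \{0, \lambda_2, \ldots, \lambda_n\}$ be a multiset of real numbers with $0 < \lambda_2 \leq \cdots \leq \lambda_n$. For $0\le k\le n-1$ let $\sigma_k$ be the $k$-th elementary symmetric function of the numbers $\lambda_2, \ldots, \lambda_n$ (with $\sigma_0=1$), and let $$f(x) = \frac{\sigma_0}{1}x^{n-1} + \frac{\sigma_1}{2}x^{n-2} + \frac{\sigma_2}{3}x^{n-3} + \cdots + \frac{\sigma_{n-1}}{n}.$$ Then $\Lambda$ is Laplacian realizable for the star $K_{1,n-1}$ if and only if $(-1)^k f(-\lambda_k) \leq 0$ for all $k = 2, \ldots, n-1$.
   Context: Graphs are finite and simple. For a graph $G$ on $n$ vertices, $\mathcal{S}_L(G)$ denotes the set of $n\times n$ real symmetric matrices $A=[a_{i,j}]$ such that $a_{i,j}<0$ if $\{i,j\}\in E(G)$, $a_{i,j}=0$ if $i\neq j$ and $\{i,j\}\notin E(G)$, and $a_{i,i}=-\sum_{k\neq i}a_{i,k}$ for all $i$. A multiset $\{0,\lambda_2,\ldots,\lambda_n\}$ of real numbers is Laplacian realizable for $G$ if there is $A\in\mathcal{S}_L(G)$ whose spectrum (multiset of eigenvalues) is $\{0,\lambda_2,\ldots,\lambda_n\}$. $K_{1,n-1}$ is the star on $n$ vertices (one central vertex adjacent to $n-1$ leaves). -}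

module Defs where

open import Level using (suc; _⊔_)
open import Algebra.Bundles using (CommutativeRing)
open import Data.Bool.Base using (if_then_else_)
open import Data.Fin.Base as Fin using (Fin; zero; toℕ; punchIn)
import Data.Fin.Properties as Fin
open import Data.List.Base as List using (List; []; _∷_; _++_; foldr)
import Data.Nat.Base as ℕ
open import Data.Nat.Base using (ℕ)
open import Data.Product.Base using (∃; _×_; _,_)
open import Data.Sum.Base using (_⊎_; inj₁; inj₂)
open import Data.Vec.Functional as Vector using (Vector)
open import Relation.Binary.Core using (Rel)
open import Relation.Binary.Definitions using (Symmetric; Irreflexive; Decidable)
open import Relation.Binary.PropositionalEquality using (_≡_; _≢_; refl)
open import Relation.Binary.Structures using (IsStrictTotalOrder)
open import Relation.Nullary.Decidable using (does; ¬?; _×-dec_; _⊎-dec_)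
open import Relation.Nullary.Negation.Core using (¬_)

-- The classical real numbers, given axiomatically as a Dedekind-complete
-- ordered field; classically such a structure is unique up to isomorphism.
-- The order is trichotomous, and least upper bounds exist for arbitrary
-- predicates. The inverse is total, with an unspecified value at 0#.
record Reals c ℓ₁ ℓ₂ : Set (suc (c ⊔ ℓ₁ ⊔ ℓ₂)) where
  infix 8 _⁻¹
  infix 4 _<_ _≤_
  field
    commutativeRing : CommutativeRing c ℓ₁

  open CommutativeRing commutativeRing public

  field
    _⁻¹                : Carrier → Carrier
    0≉1                : ¬ (0# ≈ 1#)
    ⁻¹-inverseʳ        : ∀ x → ¬ (x ≈ 0#) → x * x ⁻¹ ≈ 1#
    _<_                : Rel Carrier ℓ₂
    isStrictTotalOrder : IsStrictTotalOrder _≈_ _<_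
    +-monoˡ-<          : ∀ z {x y} → x < y → x + z < y + z
    *-pos              : ∀ {x y} → 0# < x → 0# < y → 0# < x * y

  _≤_ : Rel Carrier (ℓ₁ ⊔ ℓ₂)
  x ≤ y = x < y ⊎ x ≈ y

  UpperBound : ∀ {p} → (Carrier → Set p) → Carrier → Set (c ⊔ ℓ₁ ⊔ ℓ₂ ⊔ p)
  UpperBound P b = ∀ x → P x → x ≤ b

  field
    supremum : (P : Carrier → Set (c ⊔ ℓ₁ ⊔ ℓ₂)) → ∃ P → ∃ (UpperBound P) →
               ∃ λ s → UpperBound P s × (∀ b → UpperBound P b → s ≤ b)

record Graph (n : ℕ) : Set₁ where
  field
    Adj    : Rel (Fin n) Level.zero
    sym    : Symmetric Adj
    irrefl : Irreflexive _≡_ Adj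
    adj?   : Decidable Adj

-- The star K_{1,m}; vertex zero is the centre.
star : ∀ m → Graph (ℕ.suc m)
star m = record
  { Adj    = λ i j → (i ≡ zero × j ≢ zero) ⊎ (j ≡ zero × i ≢ zero)
  ; sym    = λ { (inj₁ p) → inj₂ p ; (inj₂ p) → inj₁ p }
  ; irrefl = λ { refl (inj₁ (p , ¬p)) → ¬p p ; refl (inj₂ (p , ¬p)) → ¬p p }
  ; adj?   = λ i j → ((i Fin.≟ zero) ×-dec ¬? (j Fin.≟ zero))
               ⊎-dec ((j Fin.≟ zero) ×-dec ¬? (i Fin.≟ zero))
  }

-- All ways of picking k positions of a list: repeated values are picked
-- separately.
choose : ∀ {a} {A : Set a} → ℕ → List A → List (List A)
choose ℕ.zero    xs       = [] ∷ []
choose (ℕ.suc k) []       = []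
choose (ℕ.suc k) (x ∷ xs) = List.map (x ∷_) (choose k xs) ++ choose (ℕ.suc k) xs

module OverReals {c ℓ₁ ℓ₂} (ℝ : Reals c ℓ₁ ℓ₂) where

  open Reals ℝ hiding (zero)
  open import Algebra.Properties.Monoid.Sum +-monoid public using (sum)
  open import Algebra.Properties.Monoid.Sum *-monoid public
    using () renaming (sum to product)
  open import Algebra.Properties.Semiring.Exp semiring public using (_^_)
  open import Algebra.Properties.Monoid.Mult +-monoid public
    using () renaming (_×_ to _·_)

  Matrix : ℕ → Set c
  Matrix n = Fin n → Fin n → Carrier

  -- Laplace expansion along the first row.
  det : ∀ {n} → Matrix n → Carrier
  det {ℕ.zero}  A = 1#
  det {ℕ.suc n} A = sum λ j →
    (- 1#) ^ toℕ j * A zero j * det (λ i k → A (Fin.suc i) (punchIn j k))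

  charPoly : ∀ {n} → Matrix n → Carrier → Carrier
  charPoly A x = det λ i j → (if does (i Fin.≟ j) then x else 0#) - A i j

  -- The multiset of entries of Λ is the multiset of eigenvalues of A, counted
  -- with algebraic multiplicity: the characteristic polynomial splits as
  -- ∏ (X - Λ i). As ℝ is infinite, polynomials are equal exactly when they
  -- agree at every point.
  HasSpectrum : ∀ {n} → Matrix n → Vector Carrier n → Set (c ⊔ ℓ₁)
  HasSpectrum A Λ = ∀ x → charPoly A x ≈ product (λ i → x - Λ i)

  record S_L {n} (G : Graph n) (A : Matrix n) : Set (ℓ₁ ⊔ ℓ₂) where
    open Graph G using (Adj)
    field
      symmetric : ∀ i j → A i j ≈ A j i
      edge      : ∀ i j → Adj i j → A i j < 0#
      nonEdge   : ∀ i j → i ≢ j → ¬ Adj i j → A i j ≈ 0#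
      diagonal  : ∀ i →
        A i i ≈ - sum (λ k → if does (k Fin.≟ i) then 0# else A i k)

  LaplacianRealizable : ∀ {n} → Graph n → Vector Carrier n → Set (c ⊔ ℓ₁ ⊔ ℓ₂)
  LaplacianRealizable G Λ = ∃ λ A → S_L G A × HasSpectrum A Λ

  σ : ∀ {m} → ℕ → Vector Carrier m → Carrier
  σ k xs = foldr _+_ 0# (List.map (foldr _*_ 1#) (choose k (Vector.toList xs)))

  f : ∀ {m} → Vector Carrier m → Carrier → Carrier
  f {m} xs x = sum λ (k : Fin (ℕ.suc m)) →
    σ (toℕ k) xs * (ℕ.suc (toℕ k) · 1#) ⁻¹ * x ^ (m ℕ.∸ toℕ k)

  -- The vector of length m = n - 1 lists λ₂, …, λₙ: its entry at i is λ_{2+i}.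

  PositiveNondecreasing : ∀ {m} → Vector Carrier (ℕ.suc m) → Set (ℓ₁ ⊔ ℓ₂)
  PositiveNondecreasing λs =
    0# < λs zero × (∀ i j → i Fin.≤ j → λs i ≤ λs j)

  SignCondition : ∀ {m} → Vector Carrier m → Set (ℓ₁ ⊔ ℓ₂)
  SignCondition {m} λs = ∀ (i : Fin m) → let k = 2 ℕ.+ toℕ i in
    k ℕ.≤ m → (- 1#) ^ k * f λs (- λs i) ≤ 0#

{-# OPTIONS --safe #-}

-- Put Q = (-1)^(n-1) f(-X) and P = ∏ (X - λₖ); then P = n Q - X Q′.  The
-- characteristic polynomial of the star Laplacian with edge weights aᵢ is
-- X (n R - X R′) with R = ∏ (X - aᵢ), so Λ is realizable exactly when Q splits
-- with positive roots.  If it does, then at a root λ of P the Wronskian gives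
-- P′(λ) Q(λ) = ∑ aᵢ ∏_{j ≠ i} (λ - aⱼ)² ≥ 0, which fixes the sign of Q(λ).
-- Conversely, a common root of P and Q is a root of Q of at least its
-- multiplicity in P; dividing common factors out leaves strict sign changes, and
-- the intermediate value theorem provides the other roots.

module Submission where

-- The sign conditions are weak and the `λₖ` may repeat, so counting sign changes cannot by itself
-- locate the roots of `Q`: next to a common root of `P` and `Q` a sign change may be missing. The
-- remedy is that `Q ↦ n Q - X Q′` lowers the order of vanishing at a point `t ≠ 0` by exactly one:
-- `(X - t)^j b` goes to `(X - t)^(j - 1)` times a factor with value `- j t b(t)` at `t`. So a
-- common root is not exhausted in `Q` before it is exhausted in `P`, and the induction carries
-- multiplicities next to signs.
--
-- Two signs are not prescribed. The one at `0` is read off the constant coefficient of `Q`. The one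
-- at the largest root is automatic, because `Q` averages rescaled copies of `P`; this is why the
-- condition stops at `k = n - 1`.
--
-- Derivatives are values of quotients by `X - t`, so analysis enters only through continuity and
-- least upper bounds.

open import Defs
open import Algebra.Bundles using (CommutativeRing)
import Algebra.Properties.Ring as RingProperties
import Algebra.Properties.Semiring.Mult.TCOptimised as Multiples
import Algebra.Solver.Ring as RingSolver
open import Algebra.Solver.Ring.AlmostCommutativeRing
  using (fromCommutativeRing; _-Raw-AlmostCommutative⟶_)
open import Data.Bool.Base using (if_then_else_)
open import Data.Empty using (⊥-elim)
open import Data.Empty.Polymorphic using (⊥)
open import Data.Fin.Base as Fin using (Fin; toℕ; punchIn)
import Data.Fin.Properties as Fin
open import Data.Integer.Base as ℤ using (ℤ; +_; -[1+_])
import Data.Integer.Properties as ℤ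
open import Data.List.Base as List using (List; _++_; foldr)
open import Data.List.Properties using (map-++)
open import Data.Maybe.Base as Maybe using (Maybe)
open import Data.Nat.Base as ℕ using (ℕ; zero; suc)
import Data.Nat.Properties as ℕ
open import Data.Product.Base using (∃; _×_; _,_; proj₁; proj₂)
import Data.Sign.Base as Sign
open import Data.Sum.Base using (inj₁; inj₂)
open import Data.Unit.Polymorphic.Base using (⊤; tt)
open import Data.Vec.Functional as Vector using (Vector)
open import Function.Base using (_∘_)
open import Function.Bundles using (_⇔_; mk⇔)
open import Level using (Lift; lift; lower; _⊔_)
open import Relation.Binary.Consequences using (dec⇒weaklyDec)
open import Relation.Binary.Definitions using (tri<; tri≈; tri>)
open import Relation.Binary.PropositionalEquality as ≡ using (_≡_)
open import Relation.Binary.Structures using (IsStrictTotalOrder)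
open import Relation.Nullary.Decidable.Core using (Dec; yes; no; does)
open import Relation.Nullary.Negation.Core using (¬_)

-- The standard ring solver with integer coefficients, so that opposite terms
-- cancel although equality of ring elements does not compute.
module IntegerRingSolver {c ℓ} (R : CommutativeRing c ℓ) where

  open CommutativeRing R renaming (zero to *-zero)
  open RingProperties ring
  open Multiples semiring using (×-homo-+; ×1-homo-*; 1+×) renaming (_×_ to _×′_)
  open import Relation.Binary.Reasoning.Setoid setoid

  ⟦_⟧ℤ : ℤ → Carrier
  ⟦ + n ⟧ℤ      = n ×′ 1#
  ⟦ -[1+ n ] ⟧ℤ = - (suc n ×′ 1#)

  ⊖-homo : ∀ m n → ⟦ m ℤ.⊖ n ⟧ℤ ≈ m ×′ 1# - n ×′ 1#
  ⊖-homo m       zero    = begin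
    m ×′ 1#         ≈⟨ +-identityʳ _ ⟨
    m ×′ 1# + 0#    ≈⟨ +-congˡ -0#≈0# ⟨
    m ×′ 1# - 0#    ∎
  ⊖-homo zero    (suc n) = sym (+-identityˡ _)
  ⊖-homo (suc m) (suc n) = begin
    ⟦ suc m ℤ.⊖ suc n ⟧ℤ                   ≡⟨ ≡.cong ⟦_⟧ℤ (ℤ.[1+m]⊖[1+n]≡m⊖n m n) ⟩
    ⟦ m ℤ.⊖ n ⟧ℤ                           ≈⟨ ⊖-homo m n ⟩
    m ×′ 1# - n ×′ 1#                      ≈⟨ +-congʳ (+-identityʳ _) ⟨
    (m ×′ 1# + 0#) - n ×′ 1#               ≈⟨ +-congʳ (+-congˡ (-‿inverseʳ 1#)) ⟨
    (m ×′ 1# + (1# - 1#)) - n ×′ 1#        ≈⟨ +-congʳ (+-assoc _ _ _) ⟨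
    ((m ×′ 1# + 1#) - 1#) - n ×′ 1#        ≈⟨ +-assoc _ _ _ ⟩
    (m ×′ 1# + 1#) + (- 1# - n ×′ 1#)      ≈⟨ +-cong (+-comm _ _) (-‿+-comm _ _) ⟩
    (1# + m ×′ 1#) - (1# + n ×′ 1#)        ≈⟨ +-cong (1+× m 1#) (-‿cong (1+× n 1#)) ⟨
    suc m ×′ 1# - suc n ×′ 1#              ∎

  +-homo : ∀ i j → ⟦ i ℤ.+ j ⟧ℤ ≈ ⟦ i ⟧ℤ + ⟦ j ⟧ℤ
  +-homo (+ m)      (+ n)      = ×-homo-+ 1# m n
  +-homo (+ m)      -[1+ n ]   = ⊖-homo m (suc n)
  +-homo -[1+ m ]   (+ n)      = trans (⊖-homo n (suc m)) (+-comm _ _)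
  +-homo -[1+ m ]   -[1+ n ]   = begin
    - (suc (suc (m ℕ.+ n)) ×′ 1#)          ≈⟨ -‿cong (1+× (suc (m ℕ.+ n)) 1#) ⟩
    - (1# + suc (m ℕ.+ n) ×′ 1#)           ≈⟨ -‿cong (+-congˡ (×-homo-+ 1# (suc m) n)) ⟩
    - (1# + (suc m ×′ 1# + n ×′ 1#))       ≈⟨ -‿cong (+-assoc _ _ _) ⟨
    - ((1# + suc m ×′ 1#) + n ×′ 1#)       ≈⟨ -‿cong (+-congʳ (+-comm _ _)) ⟩
    - ((suc m ×′ 1# + 1#) + n ×′ 1#)       ≈⟨ -‿cong (+-assoc _ _ _) ⟩
    - (suc m ×′ 1# + (1# + n ×′ 1#))       ≈⟨ -‿cong (+-congˡ (1+× n 1#)) ⟨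
    - (suc m ×′ 1# + suc n ×′ 1#)          ≈⟨ -‿+-comm _ _ ⟨
    - (suc m ×′ 1#) - suc n ×′ 1#          ∎

  ◃⁺ : ∀ n → ⟦ Sign.+ ℤ.◃ n ⟧ℤ ≈ n ×′ 1#
  ◃⁺ zero    = refl
  ◃⁺ (suc n) = refl

  ◃⁻ : ∀ n → ⟦ Sign.- ℤ.◃ n ⟧ℤ ≈ - (n ×′ 1#)
  ◃⁻ zero    = sym -0#≈0#
  ◃⁻ (suc n) = refl

  *-homo : ∀ i j → ⟦ i ℤ.* j ⟧ℤ ≈ ⟦ i ⟧ℤ * ⟦ j ⟧ℤ
  *-homo (+ m)    (+ n)    = trans (◃⁺ (m ℕ.* n)) (×1-homo-* m n)
  *-homo (+ m)    -[1+ n ] = trans (◃⁻ (m ℕ.* suc n))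
    (trans (-‿cong (×1-homo-* m (suc n))) (-‿distribʳ-* _ _))
  *-homo -[1+ m ] (+ n)    = trans (◃⁻ (suc m ℕ.* n))
    (trans (-‿cong (×1-homo-* (suc m) n)) (-‿distribˡ-* _ _))
  *-homo -[1+ m ] -[1+ n ] = begin
    ⟦ Sign.+ ℤ.◃ (suc m ℕ.* suc n) ⟧ℤ       ≈⟨ ◃⁺ (suc m ℕ.* suc n) ⟩
    (suc m ℕ.* suc n) ×′ 1#                 ≈⟨ ×1-homo-* (suc m) (suc n) ⟩
    (suc m ×′ 1#) * (suc n ×′ 1#)           ≈⟨ -‿involutive _ ⟨
    - - ((suc m ×′ 1#) * (suc n ×′ 1#))     ≈⟨ -‿cong (-‿distribˡ-* _ _) ⟩
    - (- (suc m ×′ 1#) * (suc n ×′ 1#))     ≈⟨ -‿distribʳ-* _ _ ⟩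
    - (suc m ×′ 1#) * - (suc n ×′ 1#)       ∎

  -‿homo : ∀ i → ⟦ ℤ.- i ⟧ℤ ≈ - ⟦ i ⟧ℤ
  -‿homo (+ zero)  = sym -0#≈0#
  -‿homo (+ suc n) = refl
  -‿homo -[1+ n ]  = sym (-‿involutive _)

  homomorphism : ℤ.+-*-rawRing -Raw-AlmostCommutative⟶ fromCommutativeRing R
  homomorphism = record
    { ⟦_⟧    = ⟦_⟧ℤ
    ; +-homo = +-homo
    ; *-homo = *-homo
    ; -‿homo = -‿homo
    ; 0-homo = refl
    ; 1-homo = refl
    }

  ⟦⟧ℤ-≟ : ∀ i j → Maybe (⟦ i ⟧ℤ ≈ ⟦ j ⟧ℤ)
  ⟦⟧ℤ-≟ i j = Maybe.map (λ i≡j → reflexive (≡.cong ⟦_⟧ℤ i≡j)) (dec⇒weaklyDec ℤ._≟_ i j)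

  open RingSolver ℤ.+-*-rawRing (fromCommutativeRing R) homomorphism ⟦⟧ℤ-≟ public
    using (solve; _:=_; _:+_; _:*_; _:-_; :-_; con; Polynomial)

module StarSpectra {c ℓ₁ ℓ₂} (ℝ : Reals c ℓ₁ ℓ₂) where

  open Reals ℝ renaming (zero to *-zero)
  open IntegerRingSolver commutativeRing
    using (solve; _:=_; _:+_; _:*_; _:-_; :-_; con; Polynomial)
  open IsStrictTotalOrder isStrictTotalOrder
    using (compare; _≟_)
    renaming (trans to <-trans; irrefl to <-irrefl; <-respˡ-≈ to <-respˡ; <-respʳ-≈ to <-respʳ)
  open import Algebra.Properties.Group +-group
    using () renaming (x∙y⁻¹≈ε⇒x≈y to x-y≈0⇒x≈y; x≈y⇒x∙y⁻¹≈ε to x≈y⇒x-y≈0)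
  open import Algebra.Properties.Monoid.Sum +-monoid using (sum-cong-≋)
  open import Algebra.Properties.Semiring.Sum semiring using (*-distribˡ-sum)
  open OverReals ℝ
  open import Relation.Binary.Reasoning.Setoid setoid

  𝟘 𝟙 : ∀ {n} → Polynomial n
  𝟘 = con (+ 0)
  𝟙 = con (+ 1)

  -- Ordered field arithmetic

  x<y⇒0<y-x : ∀ {x y} → x < y → 0# < y - x
  x<y⇒0<y-x {x} x<y = <-respˡ (-‿inverseʳ x) (+-monoˡ-< (- x) x<y)

  0<y-x⇒x<y : ∀ {x y} → 0# < y - x → x < y
  0<y-x⇒x<y {x} {y} 0<y-x = <-respˡ (+-identityˡ x)
    (<-respʳ (solve 2 (λ x y → (y :- x) :+ x := y) refl x y) (+-monoˡ-< x 0<y-x))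

  x<y⇒x≉y : ∀ {x y} → x < y → ¬ (x ≈ y)
  x<y⇒x≉y x<y x≈y = <-irrefl x≈y x<y

  +-pos : ∀ {x y} → 0# < x → 0# < y → 0# < x + y
  +-pos {x} {y} 0<x 0<y = <-trans (<-respʳ (sym (+-identityˡ y)) 0<y) (+-monoˡ-< y 0<x)

  -‿pos : ∀ {x} → x < 0# → 0# < - x
  -‿pos {x} x<0 = <-respʳ (+-identityˡ (- x)) (x<y⇒0<y-x x<0)

  -‿neg : ∀ {x} → 0# < x → - x < 0#
  -‿neg {x} 0<x = 0<y-x⇒x<y (<-respʳ (solve 1 (λ x → x := 𝟘 :- (:- x)) refl x) 0<x)

  0<1 : 0# < 1#
  0<1 with compare 0# 1#
  ... | tri< 0<1 _ _ = 0<1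
  ... | tri≈ _ 0≈1 _ = ⊥-elim (0≉1 0≈1)
  ... | tri> _ _ 1<0 = <-respʳ (solve 0 (:- 𝟙 :* :- 𝟙 := 𝟙) refl) (*-pos (-‿pos 1<0) (-‿pos 1<0))

  <⇒≱ : ∀ {x y} → x < y → ¬ (y ≤ x)
  <⇒≱ x<y (inj₁ y<x) = <-irrefl refl (<-trans x<y y<x)
  <⇒≱ x<y (inj₂ y≈x) = <-irrefl (sym y≈x) x<y

  ≮⇒≥ : ∀ {x y} → ¬ (x < y) → y ≤ x
  ≮⇒≥ {x} {y} x≮y with compare x y
  ... | tri< x<y _ _ = ⊥-elim (x≮y x<y)
  ... | tri≈ _ x≈y _ = inj₂ (sym x≈y)
  ... | tri> _ _ y<x = inj₁ y<x

  <-≤-trans : ∀ {x y z} → x < y → y ≤ z → x < z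
  <-≤-trans x<y (inj₁ y<z) = <-trans x<y y<z
  <-≤-trans x<y (inj₂ y≈z) = <-respʳ y≈z x<y

  ≤∧≉⇒< : ∀ {x y} → x ≤ y → ¬ (x ≈ y) → x < y
  ≤∧≉⇒< (inj₁ x<y) _   = x<y
  ≤∧≉⇒< (inj₂ x≈y) x≉y = ⊥-elim (x≉y x≈y)

  0≤-resp : ∀ {x y} → x ≈ y → 0# ≤ x → 0# ≤ y
  0≤-resp x≈y (inj₁ 0<x) = inj₁ (<-respʳ x≈y 0<x)
  0≤-resp x≈y (inj₂ 0≈x) = inj₂ (trans 0≈x x≈y)

  x≤y⇒0≤y-x : ∀ {x y} → x ≤ y → 0# ≤ y - x
  x≤y⇒0≤y-x (inj₁ x<y) = inj₁ (x<y⇒0<y-x x<y)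
  x≤y⇒0≤y-x (inj₂ x≈y) = inj₂ (sym (x≈y⇒x-y≈0 (sym x≈y)))

  0≤y-x⇒x≤y : ∀ {x y} → 0# ≤ y - x → x ≤ y
  0≤y-x⇒x≤y (inj₁ 0<y-x) = inj₁ (0<y-x⇒x<y 0<y-x)
  0≤y-x⇒x≤y (inj₂ 0≈y-x) = inj₂ (sym (x-y≈0⇒x≈y _ _ (sym 0≈y-x)))

  0≤-x⇒x≤0 : ∀ {x} → 0# ≤ - x → x ≤ 0#
  0≤-x⇒x≤0 {x} 0≤-x = 0≤y-x⇒x≤y (0≤-resp (sym (+-identityˡ (- x))) 0≤-x)

  x≤0⇒0≤-x : ∀ {x} → x ≤ 0# → 0# ≤ - x
  x≤0⇒0≤-x {x} x≤0 = 0≤-resp (+-identityˡ (- x)) (x≤y⇒0≤y-x x≤0)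

  +-pos-nonneg : ∀ {x y} → 0# < x → 0# ≤ y → 0# < x + y
  +-pos-nonneg {x} 0<x (inj₁ 0<y) = +-pos 0<x 0<y
  +-pos-nonneg {x} 0<x (inj₂ 0≈y) = <-respʳ (trans (sym (+-identityʳ x)) (+-congˡ 0≈y)) 0<x

  +-nonneg : ∀ {x y} → 0# ≤ x → 0# ≤ y → 0# ≤ x + y
  +-nonneg (inj₁ 0<x) 0≤y = inj₁ (+-pos-nonneg 0<x 0≤y)
  +-nonneg {x} {y} (inj₂ 0≈x) 0≤y = 0≤-resp (trans (sym (+-identityˡ y)) (+-congʳ 0≈x)) 0≤y

  *-nonneg : ∀ {x y} → 0# ≤ x → 0# ≤ y → 0# ≤ x * y
  *-nonneg (inj₁ 0<x) (inj₁ 0<y) = inj₁ (*-pos 0<x 0<y)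
  *-nonneg {x} (inj₁ _) (inj₂ 0≈y) = inj₂ (trans (sym (zeroʳ x)) (*-congˡ 0≈y))
  *-nonneg {y = y} (inj₂ 0≈x) _ = inj₂ (trans (sym (zeroˡ y)) (*-congʳ 0≈x))

  x*x-nonneg : ∀ x → 0# ≤ x * x
  x*x-nonneg x with compare 0# x
  ... | tri< 0<x _ _ = inj₁ (*-pos 0<x 0<x)
  ... | tri≈ _ 0≈x _ = *-nonneg (inj₂ 0≈x) (inj₂ 0≈x)
  ... | tri> _ _ x<0 = inj₁ (<-respʳ (solve 1 (λ x → :- x :* :- x := x :* x)
        refl x) (*-pos (-‿pos x<0) (-‿pos x<0)))

  x*y≈0⇒y≈0 : ∀ {x y} → ¬ (x ≈ 0#) → x * y ≈ 0# → y ≈ 0#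
  x*y≈0⇒y≈0 {x} {y} x≉0 xy≈0 = begin
    y                 ≈⟨ *-identityˡ y ⟨
    1# * y            ≈⟨ *-congʳ (⁻¹-inverseʳ x x≉0) ⟨
    x * x ⁻¹ * y      ≈⟨ solve 3 (λ x i y → x :* i :* y := i :* (x :* y)) refl x (x ⁻¹) y ⟩
    x ⁻¹ * (x * y)    ≈⟨ *-congˡ xy≈0 ⟩
    x ⁻¹ * 0#         ≈⟨ zeroʳ _ ⟩
    0#                ∎

  *-cancelˡ : ∀ {x y z} → ¬ (x ≈ 0#) → x * y ≈ x * z → y ≈ z
  *-cancelˡ {x} {y} {z} x≉0 xy≈xz = x-y≈0⇒x≈y y z (x*y≈0⇒y≈0 x≉0
    (trans (solve 3 (λ x y z → x :* (y :- z) := x :* y :- x :* z) refl x y z) (x≈y⇒x-y≈0 xy≈xz)))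

  x*x≈0⇒x≈0 : ∀ {x} → x * x ≈ 0# → x ≈ 0#
  x*x≈0⇒x≈0 {x} xx≈0 with compare x 0#
  ... | tri< _ x≉0 _ = x*y≈0⇒y≈0 x≉0 xx≈0
  ... | tri≈ _ x≈0 _ = x≈0
  ... | tri> _ x≉0 _ = x*y≈0⇒y≈0 x≉0 xx≈0

  pos⇒≉0 : ∀ {x} → 0# < x → ¬ (x ≈ 0#)
  pos⇒≉0 0<x x≈0 = <-irrefl (sym x≈0) 0<x

  *-pos-cancelˡ : ∀ {x y} → 0# < x → 0# < x * y → 0# < y
  *-pos-cancelˡ {x} {y} 0<x 0<xy with compare 0# y
  ... | tri< 0<y _ _ = 0<y
  ... | tri≈ _ 0≈y _ = ⊥-elim (<-irrefl (trans (sym (zeroʳ x)) (*-congˡ 0≈y)) 0<xy)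
  ... | tri> _ _ y<0 = ⊥-elim (<-irrefl (sym (solve 2 (λ x y → x :* y :+ x :* :- y := 𝟘) refl x y))
    (+-pos 0<xy (*-pos 0<x (-‿pos y<0))))

  *-nonneg-cancelˡ : ∀ {x y} → 0# < x → 0# ≤ x * y → 0# ≤ y
  *-nonneg-cancelˡ 0<x (inj₁ 0<xy) = inj₁ (*-pos-cancelˡ 0<x 0<xy)
  *-nonneg-cancelˡ 0<x (inj₂ 0≈xy) = inj₂ (sym (x*y≈0⇒y≈0 (pos⇒≉0 0<x) (sym 0≈xy)))

  ⁻¹-pos : ∀ {x} → 0# < x → 0# < x ⁻¹
  ⁻¹-pos {x} 0<x = *-pos-cancelˡ 0<x (<-respʳ (sym (⁻¹-inverseʳ x (pos⇒≉0 0<x))) 0<1)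

  -- The product over the sum falls short of `x` by `x * x / (x + y)`. Being symmetric, it lies
  -- below both arguments, with no minimum or halving.
  parallel-sum<ˡ : ∀ {x y} → 0# < x → 0# < y → x * y * (x + y) ⁻¹ < x
  parallel-sum<ˡ {x} {y} 0<x 0<y = 0<y-x⇒x<y (*-pos-cancelˡ 0<x+y (<-respʳ (sym gap) (*-pos 0<x 0<x)))
    where
    0<x+y : 0# < x + y
    0<x+y = +-pos 0<x 0<y
    gap : (x + y) * (x - x * y * (x + y) ⁻¹) ≈ x * x
    gap = begin
      (x + y) * (x - x * y * (x + y) ⁻¹)
        ≈⟨ solve 3 (λ x y i → (x :+ y) :* (x :- x :* y :* i) := (x :+ y) :* x :- x :* y :* ((x :+ y) :* i))
              refl x y ((x + y) ⁻¹) ⟩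
      (x + y) * x - x * y * ((x + y) * (x + y) ⁻¹)
        ≈⟨ +-congˡ (-‿cong (*-congˡ (⁻¹-inverseʳ _ (pos⇒≉0 0<x+y)))) ⟩
      (x + y) * x - x * y * 1#
        ≈⟨ solve 2 (λ x y → (x :+ y) :* x :- x :* y :* 𝟙 := x :* x) refl x y ⟩
      x * x ∎

  -- Congruence of `_⁻¹` is not among the axioms of `Reals`; on positive elements it follows from
  -- uniqueness of inverses.
  ⁻¹-cong-pos : ∀ {x y} → 0# < x → x ≈ y → x ⁻¹ ≈ y ⁻¹
  ⁻¹-cong-pos {x} {y} 0<x x≈y = *-cancelˡ (pos⇒≉0 0<x) (trans (⁻¹-inverseʳ x (pos⇒≉0 0<x))
    (sym (trans (*-congʳ x≈y) (⁻¹-inverseʳ y (pos⇒≉0 (<-respʳ x≈y 0<x))))))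

  abstract
    below-both : ∀ {x y} → 0# < x → 0# < y → ∃ λ h → 0# < h × h < x × h < y
    below-both {x} {y} 0<x 0<y = x * y * (x + y) ⁻¹
      , *-pos (*-pos 0<x 0<y) (⁻¹-pos (+-pos 0<x 0<y))
      , parallel-sum<ˡ 0<x 0<y
      , <-respˡ (*-cong (*-comm y x) (⁻¹-cong-pos (+-pos 0<y 0<x) (+-comm y x))) (parallel-sum<ˡ 0<y 0<x)

  -- Polynomials by their coefficients

  -- A polynomial of formal degree m is a sequence c with c k the coefficient of
  -- X^(m - k); read in X⁻¹ it is a power series, so that the factor X - t acts
  -- as 1 - t X⁻¹ and is invertible, whatever the degree.
  Coefficients : Set c
  Coefficients = ℕ → Carrier

  infix 4 _≐_
  _≐_ : Coefficients → Coefficients → Set ℓ₁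
  p ≐ q = ∀ k → p k ≈ q k

  eval : ℕ → Coefficients → Carrier → Carrier
  eval zero    p x = p 0
  eval (suc m) p x = p (suc m) + x * eval m p x

  Degree≤ : ℕ → Coefficients → Set ℓ₁
  Degree≤ m p = ∀ k → m ℕ.< k → p k ≈ 0#

  record Monic (m : ℕ) (p : Coefficients) : Set ℓ₁ where
    constructor monic
    field
      leading : p 0 ≈ 1#
      degree  : Degree≤ m p
  open Monic

  one : Coefficients
  one zero    = 1#
  one (suc _) = 0#

  -- Multiplication by `X⁻¹`: in formal degree `m + 1` it gives the polynomial that `p` gives in
  -- formal degree `m`. For `p` of degree at most `m`, raising the formal degree without the shift
  -- multiplies by `X` instead.
  shift : Coefficients → Coefficients
  shift p zero    = 0#
  shift p (suc k) = p k

  _[X-_] : Coefficients → Carrier → Coefficients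
  (p [X- t ]) zero    = p 0
  (p [X- t ]) (suc k) = p (suc k) - t * p k

  -- Synthetic division: the coefficients of the quotient are the successive Horner values of `p` at
  -- `t`. In formal degree `m + 1` the entry `m + 1` is therefore the remainder `p(t)`.
  _/[X-_] : Coefficients → Carrier → Coefficients
  (p /[X- t ]) k = eval k p t

  _-[_]_ : Coefficients → Carrier → Coefficients → Coefficients
  (p -[ s ] q) k = p k - s * q k

  -- θ q = (m + 1) q - X q′ when q has formal degree m.
  θ : Coefficients → Coefficients
  θ p k = (suc k · 1#) * p k

  θ⁻¹ : Coefficients → Coefficients
  θ⁻¹ p k = p k * (suc k · 1#) ⁻¹

  ∏[X-_] : ∀ {m} → Vector Carrier m → Coefficients
  ∏[X-_] {zero}  v = one
  ∏[X-_] {suc m} v = ∏[X- v ∘ Fin.suc ] [X- v Fin.zero ]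

  -- From `p = (X - t) q + p(t)` follows `p′(t) = q(t)`.
  derivative : ℕ → Coefficients → Carrier → Carrier
  derivative zero    p t = 0#
  derivative (suc m) p t = eval m (p /[X- t ]) t

  ≐-sym : ∀ {p q} → p ≐ q → q ≐ p
  ≐-sym p≐q k = sym (p≐q k)

  ≐-trans : ∀ {p q r} → p ≐ q → q ≐ r → p ≐ r
  ≐-trans p≐q q≐r k = trans (p≐q k) (q≐r k)

  eval-cong : ∀ m {p q x y} → p ≐ q → x ≈ y → eval m p x ≈ eval m q y
  eval-cong zero    p≐q x≈y = p≐q 0
  eval-cong (suc m) p≐q x≈y = +-cong (p≐q (suc m)) (*-cong x≈y (eval-cong m p≐q x≈y))

  [X-]-cong : ∀ t {p q} → p ≐ q → p [X- t ] ≐ q [X- t ]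
  [X-]-cong t p≐q zero    = p≐q 0
  [X-]-cong t p≐q (suc k) = +-cong (p≐q (suc k)) (-‿cong (*-congˡ (p≐q k)))

  /[X-]-cong : ∀ {s t p q} → s ≈ t → p ≐ q → p /[X- s ] ≐ q /[X- t ]
  /[X-]-cong s≈t p≐q k = eval-cong k p≐q s≈t

  θ-cong : ∀ {p q} → p ≐ q → θ p ≐ θ q
  θ-cong p≐q k = *-congˡ (p≐q k)

  -- Without a degree bound, the coefficient of `p` just beyond the formal degree survives as a
  -- constant. For a quotient by `X - t` this coefficient is the remainder, which gives division
  -- with remainder in `eval-divided`.
  eval-[X-] : ∀ m p t x → eval (suc m) (p [X- t ]) x ≈ (x - t) * eval m p x + p (suc m)
  eval-[X-] zero    p t x = solve 4 (λ p₁ p₀ t x → (p₁ :- t :* p₀) :+ x :* p₀ := (x :- t) :* p₀ :+ p₁)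
    refl (p 1) (p 0) t x
  eval-[X-] (suc m) p t x = trans (+-congˡ (*-congˡ (eval-[X-] m p t x)))
    (solve 5 (λ p₂ p₁ t x e → (p₂ :- t :* p₁) :+ x :* ((x :- t) :* e :+ p₁)
                           := (x :- t) :* (p₁ :+ x :* e) :+ p₂)
      refl (p (suc (suc m))) (p (suc m)) t x (eval m p x))

  eval-[X-]-degree : ∀ m {p} t x → Degree≤ m p → eval (suc m) (p [X- t ]) x ≈ (x - t) * eval m p x
  eval-[X-]-degree m {p} t x deg = trans (eval-[X-] m p t x)
    (trans (+-congˡ (deg (suc m) ℕ.≤-refl)) (+-identityʳ _))

  /[X-]-[X-] : ∀ p t → (p /[X- t ]) [X- t ] ≐ p
  /[X-]-[X-] p t zero    = refl
  /[X-]-[X-] p t (suc k) = solve 2 (λ a b → (a :+ b) :- b := a) refl (p (suc k)) (t * eval k p t)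

  [X-]-/[X-] : ∀ p t → (p [X- t ]) /[X- t ] ≐ p
  [X-]-/[X-] p t zero    = refl
  [X-]-/[X-] p t (suc k) = trans (+-congˡ (*-congˡ ([X-]-/[X-] p t k)))
    (solve 2 (λ a b → (a :- b) :+ b := a) refl (p (suc k)) (t * p k))

  [X-]-injective : ∀ t {p q} → p [X- t ] ≐ q [X- t ] → p ≐ q
  [X-]-injective t {p} {q} eq = ≐-trans (≐-sym ([X-]-/[X-] p t))
    (≐-trans (/[X-]-cong refl eq) ([X-]-/[X-] q t))

  [X-]-/[X-]-comm : ∀ p s t → (p [X- t ]) /[X- s ] ≐ (p /[X- s ]) [X- t ]
  [X-]-/[X-]-comm p s t zero    = refl
  [X-]-/[X-]-comm p s t (suc zero)    =
    solve 4 (λ p₁ p₀ s t → (p₁ :- t :* p₀) :+ s :* p₀ := (p₁ :+ s :* p₀) :- t :* p₀) refl (p 1) (p 0) s t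
  [X-]-/[X-]-comm p s t (suc (suc k)) = trans (+-congˡ (*-congˡ ([X-]-/[X-]-comm p s t (suc k))))
    (solve 5 (λ p₂ p₁ e s t → (p₂ :- t :* p₁) :+ s :* ((p₁ :+ s :* e) :- t :* e)
                           := (p₂ :+ s :* (p₁ :+ s :* e)) :- t :* (p₁ :+ s :* e))
      refl (p (suc (suc k))) (p (suc k)) (eval k p s) s t)

  [X-]-comm : ∀ p s t → (p [X- s ]) [X- t ] ≐ (p [X- t ]) [X- s ]
  [X-]-comm p s t zero          = refl
  [X-]-comm p s t (suc zero)    = solve 4 (λ p₁ p₀ s t → (p₁ :- s :* p₀) :- t :* p₀ := (p₁ :- t :* p₀) :- s :* p₀)
    refl (p 1) (p 0) s t
  [X-]-comm p s t (suc (suc k)) = solve 5 (λ p₂ p₁ p₀ s t →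
      (p₂ :- s :* p₁) :- t :* (p₁ :- s :* p₀) := (p₂ :- t :* p₁) :- s :* (p₁ :- t :* p₀))
    refl (p (suc (suc k))) (p (suc k)) (p k) s t

  eval-divided : ∀ m p t x → eval (suc m) p x ≈ (x - t) * eval m (p /[X- t ]) x + eval (suc m) p t
  eval-divided m p t x = trans (eval-cong (suc m) (≐-sym (/[X-]-[X-] p t)) refl) (eval-[X-] m (p /[X- t ]) t x)

  -- Once a Horner value vanishes and no coefficients are left to add, all later ones vanish. Hence
  -- the quotient series by a root is a polynomial of degree one less.
  eval-beyond : ∀ m {p t} → Degree≤ m p → eval m p t ≈ 0# → ∀ k → m ℕ.≤ k → eval k p t ≈ 0#
  eval-beyond zero        deg root zero    m≤k = root
  eval-beyond m {p} {t} deg root (suc k) m≤1+k with ℕ.m≤n⇒m<n∨m≡n m≤1+k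
  ... | inj₂ ≡.refl = root
  ... | inj₁ m<1+k  = begin
    p (suc k) + t * eval k p t  ≈⟨ +-cong (deg (suc k) m<1+k) (*-congˡ (eval-beyond m deg root k (ℕ.≤-pred m<1+k))) ⟩
    0# + t * 0#                 ≈⟨ solve 1 (λ t → 𝟘 :+ t :* 𝟘 := 𝟘) refl t ⟩
    0#                          ∎

  one-monic : Monic 0 one
  one-monic = monic refl λ { (suc k) _ → refl }

  [X-]-degree : ∀ {m p} t → Degree≤ m p → Degree≤ (suc m) (p [X- t ])
  [X-]-degree {m} {p} t deg (suc k) 1+m<1+k = begin
    p (suc k) - t * p k   ≈⟨ +-cong (deg (suc k) (ℕ.m<n⇒m<1+n m<k)) (-‿cong (*-congˡ (deg k m<k))) ⟩
    0# - t * 0#           ≈⟨ solve 1 (λ t → 𝟘 :- t :* 𝟘 := 𝟘) refl t ⟩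
    0#                    ∎
    where m<k = ℕ.≤-pred 1+m<1+k

  [X-]-monic : ∀ {m p} t → Monic m p → Monic (suc m) (p [X- t ])
  [X-]-monic t (monic lead deg) = monic lead ([X-]-degree t deg)

  /[X-]-monic : ∀ {m p t} → Monic (suc m) p → eval (suc m) p t ≈ 0# → Monic m (p /[X- t ])
  /[X-]-monic {m} (monic lead deg) root = monic lead (eval-beyond (suc m) deg root)

  ∏-monic : ∀ {m} (v : Vector Carrier m) → Monic m ∏[X- v ]
  ∏-monic {zero}  v = one-monic
  ∏-monic {suc m} v = [X-]-monic (v Fin.zero) (∏-monic (v ∘ Fin.suc))

  eval-∏ : ∀ {m} (v : Vector Carrier m) x → eval m ∏[X- v ] x ≈ product (λ i → x - v i)
  eval-∏ {zero}  v x = refl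
  eval-∏ {suc m} v x = trans (eval-[X-]-degree m (v Fin.zero) x (degree (∏-monic (v ∘ Fin.suc))))
    (*-congˡ (eval-∏ (v ∘ Fin.suc) x))

  eval-∏-root : ∀ {m} (v : Vector Carrier m) i → eval m ∏[X- v ] (v i) ≈ 0#
  eval-∏-root {suc m} v i = trans (eval-[X-]-degree m (v Fin.zero) (v i) (degree (∏-monic (v ∘ Fin.suc)))) (go i)
    where
    go : ∀ i → (v i - v Fin.zero) * eval m ∏[X- v ∘ Fin.suc ] (v i) ≈ 0#
    go Fin.zero    = trans (*-congʳ (-‿inverseʳ _)) (zeroˡ _)
    go (Fin.suc i) = trans (*-congˡ (eval-∏-root (v ∘ Fin.suc) i)) (zeroʳ _)

  eval-shift : ∀ m p x → eval (suc m) (shift p) x ≈ eval m p x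
  eval-shift zero    p x = trans (+-congˡ (zeroʳ x)) (+-identityʳ _)
  eval-shift (suc m) p x = +-congˡ (*-congˡ (eval-shift m p x))

  eval-linear : ∀ m p s q x → eval m (p -[ s ] q) x ≈ eval m p x - s * eval m q x
  eval-linear zero    p s q x = refl
  eval-linear (suc m) p s q x = trans (+-congˡ (*-congˡ (eval-linear m p s q x)))
    (solve 6 (λ a b s x e f → (a :- s :* b) :+ x :* (e :- s :* f) := (a :+ x :* e) :- s :* (b :+ x :* f))
      refl (p (suc m)) (q (suc m)) s x (eval m p x) (eval m q x))

  eval-scale : ∀ m s p x → eval m (λ k → s * p k) x ≈ s * eval m p x
  eval-scale zero    s p x = refl
  eval-scale (suc m) s p x = trans (+-congˡ (*-congˡ (eval-scale m s p x)))
    (solve 4 (λ s a x e → s :* a :+ x :* (s :* e) := s :* (a :+ x :* e)) refl s (p (suc m)) x (eval m p x))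

  derivative-cong : ∀ m {p q} t → p ≐ q → derivative m p t ≈ derivative m q t
  derivative-cong zero    t p≐q = refl
  derivative-cong (suc m) t p≐q = eval-cong m (/[X-]-cong refl p≐q) refl

  derivative-[X-] : ∀ m p s t →
    derivative (suc m) (p [X- s ]) t ≈ eval m p t + (t - s) * derivative m p t
  derivative-[X-] zero    p s t = sym (trans (+-congˡ (zeroʳ _)) (+-identityʳ _))
  derivative-[X-] (suc m) p s t = begin
    eval (suc m) ((p [X- s ]) /[X- t ]) t                      ≈⟨ eval-cong (suc m) ([X-]-/[X-]-comm p t s) refl ⟩
    eval (suc m) ((p /[X- t ]) [X- s ]) t                      ≈⟨ eval-[X-] m (p /[X- t ]) s t ⟩
    (t - s) * eval m (p /[X- t ]) t + eval (suc m) p t         ≈⟨ +-comm _ _ ⟩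
    eval (suc m) p t + (t - s) * eval m (p /[X- t ]) t         ∎

  derivative-linear : ∀ m p s q t → derivative m (p -[ s ] q) t ≈ derivative m p t - s * derivative m q t
  derivative-linear zero    p s q t = solve 1 (λ s → 𝟘 := 𝟘 :- s :* 𝟘) refl s
  derivative-linear (suc m) p s q t = trans
    (eval-cong m (λ k → eval-linear k p s q t) refl) (eval-linear m (p /[X- t ]) s (q /[X- t ]) t)

  derivative-shift : ∀ m p t → derivative (suc m) (shift p) t ≈ derivative m p t
  derivative-shift m p t = trans (eval-cong m shift-/ refl) (go m)
    where
    shift-/ : (shift p) /[X- t ] ≐ shift (p /[X- t ])
    shift-/ zero    = refl
    shift-/ (suc k) = eval-shift k p t
    go : ∀ m → eval m (shift (p /[X- t ])) t ≈ derivative m p t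
    go zero    = refl
    go (suc m) = eval-shift m (p /[X- t ]) t

  -- The Leibniz rule for `(m + 1) - X d/dX`: the new factor also raises `m` by one, so that
  -- `(X - t) p - X p = - t p` is added to `(X - t) θ p`. The shift places `p` in formal degree
  -- `m + 1`.
  θ-[X-] : ∀ p t → θ (p [X- t ]) ≐ (θ p [X- t ]) -[ t ] shift p
  θ-[X-] p t zero    = solve 2 (λ a t → a := a :- t :* 𝟘) refl ((1 · 1#) * p 0) t
  θ-[X-] p t (suc k) = solve 4 (λ n a b t → (𝟙 :+ n) :* (a :- t :* b) := ((𝟙 :+ n) :* a :- t :* (n :* b)) :- t :* b)
    refl (suc k · 1#) (p (suc k)) (p k) t

  θ-degree : ∀ {m p} → Degree≤ m p → Degree≤ m (θ p)
  θ-degree deg k m<k = trans (*-congˡ (deg k m<k)) (zeroʳ _)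

  suc·1-pos : ∀ k → 0# < suc k · 1#
  suc·1-pos zero    = <-respʳ (sym (+-identityʳ 1#)) 0<1
  suc·1-pos (suc k) = +-pos 0<1 (suc·1-pos k)

  θ-θ⁻¹ : ∀ p → θ (θ⁻¹ p) ≐ p
  θ-θ⁻¹ p k = begin
    n * (p k * n ⁻¹)   ≈⟨ solve 3 (λ n a i → n :* (a :* i) := (n :* i) :* a) refl n (p k) (n ⁻¹) ⟩
    n * n ⁻¹ * p k     ≈⟨ *-congʳ (⁻¹-inverseʳ n (pos⇒≉0 (suc·1-pos k))) ⟩
    1# * p k           ≈⟨ *-identityˡ _ ⟩
    p k                ∎
    where n = suc k · 1#

  θ-injective : ∀ {p q} → θ p ≐ θ q → p ≐ q
  θ-injective θp≐θq k = *-cancelˡ (pos⇒≉0 (suc·1-pos k)) (θp≐θq k)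

  θ⁻¹-monic : ∀ {m p} → Monic m p → Monic m (θ⁻¹ p)
  θ⁻¹-monic {m} {p} (monic lead deg) = monic lead′ λ k m<k → trans (*-congʳ (deg k m<k)) (zeroˡ _)
    where
    lead′ : θ⁻¹ p 0 ≈ 1#
    lead′ = begin
      θ⁻¹ p 0               ≈⟨ *-identityˡ _ ⟨
      1# * θ⁻¹ p 0          ≈⟨ *-congʳ (+-identityʳ 1#) ⟨
      θ (θ⁻¹ p) 0           ≈⟨ θ-θ⁻¹ p 0 ⟩
      p 0                   ≈⟨ lead ⟩
      1#                    ∎

  eval-θ-[X-] : ∀ m {p} t x → Degree≤ m p →
    eval (suc m) (θ (p [X- t ])) x ≈ (x - t) * eval m (θ p) x - t * eval m p x
  eval-θ-[X-] m {p} t x deg = begin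
    eval (suc m) (θ (p [X- t ])) x                       ≈⟨ eval-cong (suc m) (θ-[X-] p t) refl ⟩
    eval (suc m) ((θ p [X- t ]) -[ t ] shift p) x         ≈⟨ eval-linear (suc m) (θ p [X- t ]) t (shift p) x ⟩
    eval (suc m) (θ p [X- t ]) x - t * eval (suc m) (shift p) x
      ≈⟨ +-cong (eval-[X-]-degree m t x (θ-degree deg)) (-‿cong (*-congˡ (eval-shift m p x))) ⟩
    (x - t) * eval m (θ p) x - t * eval m p x            ∎

  derivative-θ-[X-] : ∀ m p s t →
    derivative (suc m) (θ (p [X- s ])) t
      ≈ (eval m (θ p) t + (t - s) * derivative m (θ p) t) - s * derivative m p t
  derivative-θ-[X-] m p s t = begin
    derivative (suc m) (θ (p [X- s ])) t                  ≈⟨ derivative-cong (suc m) t (θ-[X-] p s) ⟩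
    derivative (suc m) ((θ p [X- s ]) -[ s ] shift p) t   ≈⟨ derivative-linear (suc m) (θ p [X- s ]) s (shift p) t ⟩
    derivative (suc m) (θ p [X- s ]) t - s * derivative (suc m) (shift p) t
      ≈⟨ +-cong (derivative-[X-] m (θ p) s t) (-‿cong (*-congˡ (derivative-shift m p t))) ⟩
    (eval m (θ p) t + (t - s) * derivative m (θ p) t) - s * derivative m p t ∎

  -- Signs at the roots and the Wronskian

  Nondecreasing : ∀ {m} → Vector Carrier m → Set _
  Nondecreasing v = ∀ i j → i Fin.≤ j → v i ≤ v j

  tail-nondecreasing : ∀ {m} {v : Vector Carrier (suc m)} → Nondecreasing v → Nondecreasing (v ∘ Fin.suc)
  tail-nondecreasing mono i j i≤j = mono (Fin.suc i) (Fin.suc j) (ℕ.s≤s i≤j)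

  sgn : ℕ → Carrier
  sgn k = (- 1#) ^ k

  sgn² : ∀ k → sgn k * sgn k ≈ 1#
  sgn² zero    = *-identityˡ 1#
  sgn² (suc k) = trans (solve 1 (λ s → (:- 𝟙 :* s) :* (:- 𝟙 :* s) := s :* s) refl (sgn k)) (sgn² k)

  sgn-cancel : ∀ k x → sgn k * (sgn k * x) ≈ x
  sgn-cancel k x = trans (sym (*-assoc _ _ _)) (trans (*-congʳ (sgn² k)) (*-identityˡ x))

  -- The number of positions after `i`. For a nondecreasing `v` they index the nonpositive factors
  -- of `∏_{j ≠ i} (v i - v j)`, so `sgn (after i)` is the sign of that product unless it is zero.
  after : ∀ {m} → Fin m → ℕ
  after {suc m} Fin.zero    = m
  after {suc m} (Fin.suc i) = after i

  sgn-after : ∀ {m} (i : Fin m) → sgn (toℕ i) * sgn m ≈ - sgn (after i)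
  sgn-after {suc m} Fin.zero    = solve 1 (λ s → 𝟙 :* (:- 𝟙 :* s) := :- s) refl (sgn m)
  sgn-after {suc m} (Fin.suc i) = trans
    (solve 2 (λ s t → (:- 𝟙 :* s) :* (:- 𝟙 :* t) := s :* t) refl (sgn (toℕ i)) (sgn m)) (sgn-after i)

  eval-∏-head : ∀ {m} (v : Vector Carrier (suc m)) x →
    eval (suc m) ∏[X- v ] x ≈ (x - v Fin.zero) * eval m ∏[X- v ∘ Fin.suc ] x
  eval-∏-head {m} v x = eval-[X-]-degree m (v Fin.zero) x (degree (∏-monic (v ∘ Fin.suc)))

  sgn-eval-∏-head : ∀ {m} (v : Vector Carrier (suc m)) x →
    sgn (suc m) * eval (suc m) ∏[X- v ] x ≈ (v Fin.zero - x) * (sgn m * eval m ∏[X- v ∘ Fin.suc ] x)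
  sgn-eval-∏-head {m} v x = trans (*-congˡ (eval-∏-head v x))
    (solve 4 (λ s x a e → (:- 𝟙 :* s) :* ((x :- a) :* e) := (a :- x) :* (s :* e))
      refl (sgn m) x (v Fin.zero) (eval m ∏[X- v ∘ Fin.suc ] x))

  eval-∏-below : ∀ {m} (v : Vector Carrier m) u → (∀ i → u ≤ v i) → 0# ≤ sgn m * eval m ∏[X- v ] u
  eval-∏-below {zero}  v u u≤v = inj₁ (<-respʳ (sym (*-identityˡ 1#)) 0<1)
  eval-∏-below {suc m} v u u≤v = 0≤-resp (sym (sgn-eval-∏-head v u))
    (*-nonneg (x≤y⇒0≤y-x (u≤v Fin.zero)) (eval-∏-below (v ∘ Fin.suc) u (u≤v ∘ Fin.suc)))

  eval-∏-strictly-below : ∀ {m} (v : Vector Carrier m) u → (∀ i → u < v i) → 0# < sgn m * eval m ∏[X- v ] u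
  eval-∏-strictly-below {zero}  v u u<v = <-respʳ (sym (*-identityˡ 1#)) 0<1
  eval-∏-strictly-below {suc m} v u u<v = <-respʳ (sym (sgn-eval-∏-head v u))
    (*-pos (x<y⇒0<y-x (u<v Fin.zero)) (eval-∏-strictly-below (v ∘ Fin.suc) u (u<v ∘ Fin.suc)))

  -- The derivative at `v i` is `∏_{j ≠ i} (v i - v j)`; peeling off the first factor either leaves
  -- the product of the others or contributes `v i - v 0`. Repeated entries only make the value
  -- zero.
  derivative-at-root : ∀ {m} (v : Vector Carrier m) → Nondecreasing v →
    ∀ i → 0# ≤ sgn (after i) * derivative m ∏[X- v ] (v i)
  derivative-at-root {suc m} v mono Fin.zero = 0≤-resp
    (*-congˡ (sym (trans (derivative-[X-] m ∏[X- v ∘ Fin.suc ] v₀ v₀)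
      (solve 3 (λ e x d → e :+ (x :- x) :* d := e) refl _ v₀ _))))
    (eval-∏-below (v ∘ Fin.suc) v₀ λ j → mono Fin.zero (Fin.suc j) ℕ.z≤n)
    where v₀ = v Fin.zero
  derivative-at-root {suc m} v mono (Fin.suc i) = 0≤-resp
    (sym (begin
      s * derivative (suc m) ∏[X- v ] x                  ≈⟨ *-congˡ (derivative-[X-] m ∏[X- v ∘ Fin.suc ] (v Fin.zero) x) ⟩
      s * (eval m ∏[X- v ∘ Fin.suc ] x + (x - v Fin.zero) * d) ≈⟨ *-congˡ (+-congʳ (eval-∏-root (v ∘ Fin.suc) i)) ⟩
      s * (0# + (x - v Fin.zero) * d)                    ≈⟨ solve 3 (λ s y d → s :* (𝟘 :+ y :* d) := y :* (s :* d))
            refl s (x - v Fin.zero) d ⟩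
      (x - v Fin.zero) * (s * d)                         ∎))
    (*-nonneg (x≤y⇒0≤y-x (mono Fin.zero (Fin.suc i) ℕ.z≤n))
              (derivative-at-root (v ∘ Fin.suc) (tail-nondecreasing mono) i))
    where
    x = v (Fin.suc i)
    s = sgn (after i)
    d = derivative m ∏[X- v ∘ Fin.suc ] x

  -- ∑ᵢ aᵢ Qᵢ(t)² with Qᵢ = ∏_{j ≠ i} (X - aⱼ).
  weightedSquares : ∀ {m} → Vector Carrier m → Carrier → Carrier
  weightedSquares {zero}  a t = 0#
  weightedSquares {suc m} a t =
    a Fin.zero * (eval m ∏[X- a ∘ Fin.suc ] t * eval m ∏[X- a ∘ Fin.suc ] t)
    + (t - a Fin.zero) * (t - a Fin.zero) * weightedSquares (a ∘ Fin.suc) t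

  -- For `Q = ∏[X- a ]`, `θ Q / Q = 1 - ∑ aᵢ / (X - aᵢ)`, and the left side is `Q²` times the
  -- derivative `∑ aᵢ / (X - aᵢ)²` of this. Induction on the factors avoids the division and so
  -- covers the roots of `Q` as well.
  wronskian : ∀ {m} (a : Vector Carrier m) t →
    derivative m (θ ∏[X- a ]) t * eval m ∏[X- a ] t - eval m (θ ∏[X- a ]) t * derivative m ∏[X- a ] t
      ≈ weightedSquares a t
  wronskian {zero}  a t = solve 2 (λ x y → 𝟘 :* x :- y :* 𝟘 := 𝟘) refl _ _
  wronskian {suc m} a t = begin
    derivative (suc m) (θ ∏[X- a ]) t * eval (suc m) ∏[X- a ] t - eval (suc m) (θ ∏[X- a ]) t * derivative (suc m) ∏[X- a ] t
      ≈⟨ +-cong (*-cong (derivative-θ-[X-] m Q a₀ t) (eval-∏-head a t))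
                (-‿cong (*-cong (eval-θ-[X-] m a₀ t (degree (∏-monic (a ∘ Fin.suc)))) (derivative-[X-] m Q a₀ t))) ⟩
    ((p + (t - a₀) * p′) - a₀ * q′) * ((t - a₀) * q) - ((t - a₀) * p - a₀ * q) * (q + (t - a₀) * q′)
      ≈⟨ solve 6 (λ a t p p′ q q′ →
           ((p :+ (t :- a) :* p′) :- a :* q′) :* ((t :- a) :* q) :- ((t :- a) :* p :- a :* q) :* (q :+ (t :- a) :* q′)
           := a :* (q :* q) :+ (t :- a) :* (t :- a) :* (p′ :* q :- p :* q′)) refl a₀ t p p′ q q′ ⟩
    a₀ * (q * q) + (t - a₀) * (t - a₀) * (p′ * q - p * q′)
      ≈⟨ +-congˡ (*-congˡ (wronskian (a ∘ Fin.suc) t)) ⟩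
    weightedSquares a t ∎
    where
    Q  = ∏[X- a ∘ Fin.suc ]
    a₀ = a Fin.zero
    p  = eval m (θ Q) t
    p′ = derivative m (θ Q) t
    q  = eval m Q t
    q′ = derivative m Q t

  weightedSquares-nonneg : ∀ {m} (a : Vector Carrier m) t → (∀ i → 0# < a i) → 0# ≤ weightedSquares a t
  weightedSquares-nonneg {zero}  a t 0<a = inj₂ refl
  weightedSquares-nonneg {suc m} a t 0<a = +-nonneg
    (*-nonneg (inj₁ (0<a Fin.zero)) (x*x-nonneg _))
    (*-nonneg (x*x-nonneg _) (weightedSquares-nonneg (a ∘ Fin.suc) t (0<a ∘ Fin.suc)))

  -- A vanishing sum of nonnegative terms has a vanishing first term; its weight is positive, so
  -- `∏_{j ≠ 0} (t - aⱼ)` is zero, and this is a factor of `Q(t)`.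
  weightedSquares≈0⇒root : ∀ {m} (a : Vector Carrier (suc m)) t → (∀ i → 0# < a i) →
    weightedSquares a t ≈ 0# → eval (suc m) ∏[X- a ] t ≈ 0#
  weightedSquares≈0⇒root {m} a t 0<a sum≈0 with x*x-nonneg (eval m ∏[X- a ∘ Fin.suc ] t)
  ... | inj₁ 0<q² = ⊥-elim (pos⇒≉0 (+-pos-nonneg (*-pos (0<a Fin.zero) 0<q²)
          (*-nonneg (x*x-nonneg _) (weightedSquares-nonneg (a ∘ Fin.suc) t (0<a ∘ Fin.suc)))) sum≈0)
  ... | inj₂ 0≈q² = trans (eval-∏-head a t) (trans (*-congˡ (x*x≈0⇒x≈0 (sym 0≈q²))) (zeroʳ _))

  interlacing-signs : ∀ {m} (v a : Vector Carrier (suc m)) → Nondecreasing v → (∀ i → 0# < a i) →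
    ∏[X- v ] ≐ θ ∏[X- a ] → ∀ i → 0# ≤ sgn (after i) * eval (suc m) ∏[X- a ] (v i)
  interlacing-signs {m} v a mono 0<a P≐θQ i = result (derivative-at-root v mono i)
    where
    t  = v i
    s  = sgn (after i)
    p′ = derivative (suc m) ∏[X- v ] t
    q  = eval (suc m) ∏[X- a ] t
    q′ = derivative (suc m) ∏[X- a ] t
    p′q : p′ * q ≈ weightedSquares a t
    p′q = begin
      p′ * q                                        ≈⟨ solve 3 (λ p q q′ → p :* q := p :* q :- 𝟘 :* q′)
            refl p′ q q′ ⟩
      p′ * q - 0# * q′                              ≈⟨ +-congˡ (-‿cong (*-congʳ (eval-∏-root v i))) ⟨
      p′ * q - eval (suc m) ∏[X- v ] t * q′         ≈⟨ +-cong (*-congʳ (derivative-cong (suc m) t P≐θQ))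
                                                         (-‿cong (*-congʳ (eval-cong (suc m) P≐θQ refl))) ⟩
      derivative (suc m) (θ ∏[X- a ]) t * q - eval (suc m) (θ ∏[X- a ]) t * q′ ≈⟨ wronskian a t ⟩
      weightedSquares a t                           ∎
    sp′sq : (s * p′) * (s * q) ≈ weightedSquares a t
    sp′sq = begin
      (s * p′) * (s * q)      ≈⟨ solve 3 (λ s p q → (s :* p) :* (s :* q) := (s :* s) :* (p :* q)) refl s p′ q ⟩
      (s * s) * (p′ * q)      ≈⟨ *-cong (sgn² (after i)) p′q ⟩
      1# * weightedSquares a t ≈⟨ *-identityˡ _ ⟩
      weightedSquares a t     ∎
    -- At a simple root the factor `s * p′` can be cancelled; at a multiple root the weighted
    -- squares sum to zero, so `Q` vanishes there.
    result : 0# ≤ s * p′ → 0# ≤ s * q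
    result (inj₁ 0<sp′) = *-nonneg-cancelˡ 0<sp′ (0≤-resp (sym sp′sq) (weightedSquares-nonneg a t 0<a))
    result (inj₂ 0≈sp′) = inj₂ (sym (trans (*-congˡ (weightedSquares≈0⇒root a t 0<a
      (trans (sym sp′sq) (trans (*-congʳ (sym 0≈sp′)) (zeroˡ _))))) (zeroʳ s)))

  -- Vieta's formulas and the polynomial `f`

  sum-eval : ∀ m p x → sum {suc m} (λ k → p (toℕ k) * x ^ (m ℕ.∸ toℕ k)) ≈ eval m p x
  sum-eval zero    p x = trans (+-identityʳ _) (*-identityʳ _)
  sum-eval (suc m) p x = trans (+-congˡ (sum-eval m (p ∘ suc) x)) (sym (eval-front m p))
    where
    eval-front : ∀ m p → eval (suc m) p x ≈ p 0 * x ^ suc m + eval m (p ∘ suc) x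
    eval-front zero    p = solve 3 (λ p₀ p₁ x → p₁ :+ x :* p₀ := p₀ :* (x :* 𝟙) :+ p₁) refl (p 0) (p 1) x
    eval-front (suc m) p = trans (+-congˡ (*-congˡ (eval-front m p)))
      (solve 5 (λ p₀ p₂ x y e → p₂ :+ x :* (p₀ :* y :+ e) := p₀ :* (x :* y) :+ (p₂ :+ x :* e))
        refl (p 0) (p (suc (suc m))) x (x ^ suc m) (eval m (p ∘ suc) x))

  eval-neg : ∀ m p x → eval m p (- x) ≈ sgn m * eval m (λ k → sgn k * p k) x
  eval-neg zero    p x = sym (trans (*-identityˡ _) (*-identityˡ _))
  eval-neg (suc m) p x = begin
    p (suc m) + - x * eval m p (- x)         ≈⟨ +-cong (sym (sgn-cancel (suc m) _)) (*-congˡ (eval-neg m p x)) ⟩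
    sgn (suc m) * (sgn (suc m) * p (suc m)) + - x * (sgn m * e)
      ≈⟨ solve 4 (λ s y x e → (:- 𝟙 :* s) :* y :+ :- x :* (s :* e) := (:- 𝟙 :* s) :* (y :+ x :* e))
           refl (sgn m) (sgn (suc m) * p (suc m)) x e ⟩
    sgn (suc m) * (sgn (suc m) * p (suc m) + x * e) ∎
    where e = eval m (λ k → sgn k * p k) x

  listSum listProduct : List Carrier → Carrier
  listSum = foldr _+_ 0#
  listProduct = foldr _*_ 1#

  listSum-++ : ∀ xs ys → listSum (xs ++ ys) ≈ listSum xs + listSum ys
  listSum-++ List.[]       ys = sym (+-identityˡ _)
  listSum-++ (x List.∷ xs) ys = trans (+-congˡ (listSum-++ xs ys)) (sym (+-assoc _ _ _))

  listSum-∷ : ∀ x xss → listSum (List.map listProduct (List.map (x List.∷_) xss)) ≈ x * listSum (List.map listProduct xss)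
  listSum-∷ x List.[]         = sym (zeroʳ x)
  listSum-∷ x (xs List.∷ xss) = trans (+-congˡ (listSum-∷ x xss)) (sym (distribˡ _ _ _))

  σ-suc : ∀ {m} k (v : Vector Carrier (suc m)) →
    σ (suc k) v ≈ v Fin.zero * σ k (v ∘ Fin.suc) + σ (suc k) (v ∘ Fin.suc)
  σ-suc k v = begin
    listSum (List.map listProduct (List.map (v₀ List.∷_) (choose k vs) ++ choose (suc k) vs))
      ≡⟨ ≡.cong listSum (map-++ listProduct (List.map (v₀ List.∷_) (choose k vs)) (choose (suc k) vs)) ⟩
    listSum (List.map listProduct (List.map (v₀ List.∷_) (choose k vs)) ++ List.map listProduct (choose (suc k) vs))
      ≈⟨ listSum-++ (List.map listProduct (List.map (v₀ List.∷_) (choose k vs))) _ ⟩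
    listSum (List.map listProduct (List.map (v₀ List.∷_) (choose k vs))) + σ (suc k) (v ∘ Fin.suc)
      ≈⟨ +-congʳ (listSum-∷ v₀ (choose k vs)) ⟩
    v₀ * σ k (v ∘ Fin.suc) + σ (suc k) (v ∘ Fin.suc) ∎
    where
    v₀ = v Fin.zero
    vs = Vector.toList (v ∘ Fin.suc)

  vieta : ∀ {m} (v : Vector Carrier m) k → ∏[X- v ] k ≈ sgn k * σ k v
  vieta {zero}  v zero    = solve 0 (𝟙 := 𝟙 :* (𝟙 :+ 𝟘)) refl
  vieta {zero}  v (suc k) = sym (zeroʳ _)
  vieta {suc m} v zero    = vieta (v ∘ Fin.suc) zero
  vieta {suc m} v (suc k) = begin
    ∏[X- v ∘ Fin.suc ] (suc k) - v₀ * ∏[X- v ∘ Fin.suc ] k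
      ≈⟨ +-cong (vieta (v ∘ Fin.suc) (suc k)) (-‿cong (*-congˡ (vieta (v ∘ Fin.suc) k))) ⟩
    sgn (suc k) * σ (suc k) (v ∘ Fin.suc) - v₀ * (sgn k * σ k (v ∘ Fin.suc))
      ≈⟨ solve 4 (λ s a x b → (:- 𝟙 :* s) :* a :- x :* (s :* b) := (:- 𝟙 :* s) :* (x :* b :+ a))
           refl (sgn k) (σ (suc k) (v ∘ Fin.suc)) v₀ (σ k (v ∘ Fin.suc)) ⟩
    sgn (suc k) * (v₀ * σ k (v ∘ Fin.suc) + σ (suc k) (v ∘ Fin.suc))
      ≈⟨ *-congˡ (σ-suc k v) ⟨
    sgn (suc k) * σ (suc k) v ∎
    where v₀ = v Fin.zero

  f-eval : ∀ {m} (v : Vector Carrier m) x → f v (- x) ≈ sgn m * eval m (θ⁻¹ ∏[X- v ]) x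
  f-eval {m} v x = begin
    f v (- x)                                                 ≈⟨ sum-eval m (θ⁻¹ (λ k → σ k v)) (- x) ⟩
    eval m (θ⁻¹ (λ k → σ k v)) (- x)                           ≈⟨ eval-neg m (θ⁻¹ (λ k → σ k v)) x ⟩
    sgn m * eval m (λ k → sgn k * θ⁻¹ (λ k → σ k v) k) x        ≈⟨ *-congˡ (eval-cong m signed refl) ⟩
    sgn m * eval m (θ⁻¹ ∏[X- v ]) x                            ∎
    where
    signed : (λ k → sgn k * θ⁻¹ (λ k → σ k v) k) ≐ θ⁻¹ ∏[X- v ]
    signed k = trans (sym (*-assoc _ _ _)) (*-congʳ (sym (vieta v k)))

  -- With `k = 2 + i` and `i + after i + 1 = m`, the signs combine to
  -- `(-1)^k (-1)^m = - (-1)^(after i)`. The sign condition thus asks `sgn (after i)` times `Q` to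
  -- be nonnegative at `v i`.
  sgn-f : ∀ {m} (v : Vector Carrier m) i →
    sgn (2 ℕ.+ toℕ i) * f v (- v i) ≈ - (sgn (after i) * eval m (θ⁻¹ ∏[X- v ]) (v i))
  sgn-f {m} v i = begin
    sgn (2 ℕ.+ toℕ i) * f v (- v i)      ≈⟨ *-congˡ (f-eval v (v i)) ⟩
    sgn (2 ℕ.+ toℕ i) * (sgn m * e)      ≈⟨ solve 3 (λ s t e → (:- 𝟙 :* (:- 𝟙 :* s)) :* (t :* e) := (s :* t) :* e)
                                            refl (sgn (toℕ i)) (sgn m) e ⟩
    sgn (toℕ i) * sgn m * e              ≈⟨ *-congʳ (sgn-after i) ⟩
    - sgn (after i) * e                  ≈⟨ solve 2 (λ s e → :- s :* e := :- (s :* e)) refl (sgn (after i)) e ⟩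
    - (sgn (after i) * e)                ∎
    where e = eval m (θ⁻¹ ∏[X- v ]) (v i)

  -- Continuity and intermediate values

  -- Two nonnegativity conditions replace an absolute value, so that bounds on sums and products
  -- become sums and products of nonnegative terms.
  ∣_∣≤_ : Carrier → Carrier → Set _
  ∣ x ∣≤ M = 0# ≤ M - x × 0# ≤ M + x

  bounded : ∀ x → ∃ λ M → 0# < M × ∣ x ∣≤ M
  bounded x with compare 0# x
  ... | tri< 0<x _ _ = x , 0<x , inj₂ (sym (-‿inverseʳ x)) , inj₁ (+-pos 0<x 0<x)
  ... | tri≈ _ 0≈x _ = 1# , 0<1 , inj₁ (x<y⇒0<y-x (<-respˡ 0≈x 0<1)) , inj₁ (+-pos-nonneg 0<1 (inj₂ 0≈x))
  ... | tri> _ _ x<0 = - x , -‿pos x<0 , inj₁ (+-pos (-‿pos x<0) (-‿pos x<0)) , inj₂ (sym (-‿inverseˡ x))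

  ∣∣≤-+ : ∀ {x y K M} → ∣ x ∣≤ K → ∣ y ∣≤ M → ∣ x + y ∣≤ (K + M)
  ∣∣≤-+ {x} {y} {K} {M} (x≤K , -x≤K) (y≤M , -y≤M) =
      0≤-resp (solve 4 (λ x y K M → (K :- x) :+ (M :- y) := (K :+ M) :- (x :+ y))
            refl x y K M) (+-nonneg x≤K y≤M)
    , 0≤-resp (solve 4 (λ x y K M → (K :+ x) :+ (M :+ y) := (K :+ M) :+ (x :+ y))
          refl x y K M) (+-nonneg -x≤K -y≤M)

  -- (K - x)(M + y) + (K + x)(M - y) = 2 (K M - x y), and similarly for K M + x y.
  ∣∣≤-* : ∀ {x y K M} → ∣ x ∣≤ K → ∣ y ∣≤ M → ∣ x * y ∣≤ (K * M)
  ∣∣≤-* {x} {y} {K} {M} (x≤K , -x≤K) (y≤M , -y≤M) =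
      *-nonneg-cancelˡ (+-pos 0<1 0<1) (0≤-resp
        (solve 4 (λ x y K M → (K :- x) :* (M :+ y) :+ (K :+ x) :* (M :- y) := (𝟙 :+ 𝟙) :* (K :* M :- x :* y))
              refl x y K M)
        (+-nonneg (*-nonneg x≤K -y≤M) (*-nonneg -x≤K y≤M)))
    , *-nonneg-cancelˡ (+-pos 0<1 0<1) (0≤-resp
        (solve 4 (λ x y K M → (K :- x) :* (M :- y) :+ (K :+ x) :* (M :+ y) := (𝟙 :+ 𝟙) :* (K :* M :+ x :* y))
              refl x y K M)
        (+-nonneg (*-nonneg x≤K y≤M) (*-nonneg -x≤K -y≤M)))

  eval-bounded : ∀ m p {K} → 0# < K → ∃ λ M → 0# < M × (∀ x → ∣ x ∣≤ K → ∣ eval m p x ∣≤ M)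
  eval-bounded zero    p     0<K with bounded (p 0)
  ... | M , 0<M , p₀≤M = M , 0<M , λ _ _ → p₀≤M
  eval-bounded (suc m) p {K} 0<K with bounded (p (suc m)) | eval-bounded m p 0<K
  ... | A , 0<A , pₘ≤A | M , 0<M , bound =
    A + K * M , +-pos 0<A (*-pos 0<K 0<M) , λ x x≤K → ∣∣≤-+ pₘ≤A (∣∣≤-* x≤K (bound x x≤K))

  -- Division with remainder gives `p(t + h) = p(t) + h r(t + h)` with `r` bounded near `t`.
  eval-positive-near : ∀ m p t → 0# < eval m p t →
    ∃ λ δ → 0# < δ × (∀ h → ∣ h ∣≤ δ → 0# < eval m p (t + h))
  eval-positive-near zero    p t 0<v = 1# , 0<1 , λ _ _ → 0<v
  eval-positive-near (suc m) p t 0<v with bounded t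
  ... | B , 0<B , t≤B with eval-bounded m (p /[X- t ]) (+-pos 0<B 0<1)
  -- `δ < 1` keeps `t + h` within `B + 1`, where `M` bounds the quotient; `δ < v / M` keeps `h r`
  -- below `v` in size.
  ... | M , 0<M , bound with below-both 0<1 (*-pos 0<v (⁻¹-pos 0<M))
  ... | δ , 0<δ , δ<1 , δ<v/M = δ , 0<δ , λ h h≤δ → <-respʳ (sym (eq h))
          (+-pos-nonneg 0<v-δM (proj₂ (∣∣≤-* h≤δ (bound (t + h) (∣∣≤-+ t≤B (weaken h≤δ))))))
    where
    v = eval (suc m) p t
    r = λ h → eval m (p /[X- t ]) (t + h)
    weaken : ∀ {h} → ∣ h ∣≤ δ → ∣ h ∣≤ 1#
    weaken {h} (h≤δ , -h≤δ) =
        0≤-resp (solve 2 (λ δ h → (𝟙 :- δ) :+ (δ :- h) := 𝟙 :- h)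
              refl δ h) (+-nonneg (inj₁ (x<y⇒0<y-x δ<1)) h≤δ)
      , 0≤-resp (solve 2 (λ δ h → (𝟙 :- δ) :+ (δ :+ h) := 𝟙 :+ h)
            refl δ h) (+-nonneg (inj₁ (x<y⇒0<y-x δ<1)) -h≤δ)
    0<v-δM : 0# < v - δ * M
    0<v-δM = <-respʳ (begin
      M * (v * M ⁻¹ - δ)       ≈⟨ solve 4 (λ M v i δ → M :* (v :* i :- δ) := v :* (M :* i) :- δ :* M)
            refl M v (M ⁻¹) δ ⟩
      v * (M * M ⁻¹) - δ * M   ≈⟨ +-congʳ (*-congˡ (⁻¹-inverseʳ M (pos⇒≉0 0<M))) ⟩
      v * 1# - δ * M           ≈⟨ +-congʳ (*-identityʳ v) ⟩
      v - δ * M                ∎) (*-pos 0<M (x<y⇒0<y-x δ<v/M))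
    eq : ∀ h → eval (suc m) p (t + h) ≈ (v - δ * M) + (δ * M + h * r h)
    eq h = trans (eval-divided m p t (t + h))
      (solve 6 (λ t h r v δ M → ((t :+ h) :- t) :* r :+ v := (v :- δ :* M) :+ (δ :* M :+ h :* r))
            refl t h (r h) v δ M)

  eval-scale-neg : ∀ m p x → eval m (λ k → - 1# * p k) x ≈ - eval m p x
  eval-scale-neg m p x = trans (eval-scale m (- 1#) p x) (solve 1 (λ e → :- 𝟙 :* e := :- e) refl (eval m p x))

  eval-negative-near : ∀ m p t → eval m p t < 0# →
    ∃ λ δ → 0# < δ × (∀ h → ∣ h ∣≤ δ → eval m p (t + h) < 0#)
  eval-negative-near m p t v<0 =
    let δ , 0<δ , near = eval-positive-near m (λ k → - 1# * p k) t (<-respʳ (sym (eval-scale-neg m p t)) (-‿pos v<0))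
    in δ , 0<δ , λ h h≤δ → <-respˡ (solve 1 (λ e → :- :- e := e)
          refl _) (-‿neg (<-respʳ (eval-scale-neg m p (t + h)) (near h h≤δ)))

  ∣∣≤-refl : ∀ {δ} → 0# < δ → ∣ δ ∣≤ δ
  ∣∣≤-refl {δ} 0<δ = inj₂ (sym (-‿inverseʳ δ)) , inj₁ (+-pos 0<δ 0<δ)

  x+δ≉x : ∀ {x δ} → 0# < δ → ¬ (x + δ ≈ x)
  x+δ≉x {x} {δ} 0<δ eq = pos⇒≉0 0<δ (trans (solve 2 (λ x δ → δ := (x :+ δ) :- x) refl x δ) (x≈y⇒x-y≈0 eq))

  eval≈0-punctured : ∀ m p t → (∀ x → ¬ (x ≈ t) → eval m p x ≈ 0#) → eval m p t ≈ 0#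
  eval≈0-punctured m p t vanishes with compare (eval m p t) 0#
  ... | tri< v<0 _ _ = let δ , 0<δ , near = eval-negative-near m p t v<0 in
    ⊥-elim (x<y⇒x≉y (near δ (∣∣≤-refl 0<δ)) (vanishes (t + δ) (x+δ≉x 0<δ)))
  ... | tri≈ _ v≈0 _ = v≈0
  ... | tri> _ _ 0<v = let δ , 0<δ , near = eval-positive-near m p t 0<v in
    ⊥-elim (pos⇒≉0 (near δ (∣∣≤-refl 0<δ)) (vanishes (t + δ) (x+δ≉x 0<δ)))

  -- The constant coefficient is the value at `0`, zero by continuity; what remains is `p(x) / x`,
  -- which again is only known to vanish away from `0`. Excluding `0` in the hypothesis is what
  -- makes the induction go through.
  vanishing-coefficients : ∀ m p → (∀ x → ¬ (x ≈ 0#) → eval m p x ≈ 0#) → ∀ k → k ℕ.≤ m → p k ≈ 0#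
  vanishing-coefficients zero    p vanishes zero _ = vanishes 1# λ 1≈0 → 0≉1 (sym 1≈0)
  vanishing-coefficients (suc m) p vanishes = go
    where
    constant≈0 : p (suc m) ≈ 0#
    constant≈0 = trans (solve 2 (λ a e → a := a :+ 𝟘 :* e) refl (p (suc m)) (eval m p 0#))
      (eval≈0-punctured (suc m) p 0# vanishes)
    quotient≈0 : ∀ x → ¬ (x ≈ 0#) → eval m p x ≈ 0#
    quotient≈0 x x≉0 = x*y≈0⇒y≈0 x≉0 (trans (sym (+-identityˡ _)) (trans (+-congʳ (sym constant≈0)) (vanishes x x≉0)))
    go : ∀ k → k ℕ.≤ suc m → p k ≈ 0#
    go k k≤1+m with ℕ.m≤n⇒m<n∨m≡n k≤1+m
    ... | inj₁ k<1+m  = vanishing-coefficients m p quotient≈0 k (ℕ.≤-pred k<1+m)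
    ... | inj₂ ≡.refl = constant≈0

  identity-theorem : ∀ m {p q} → Degree≤ m p → Degree≤ m q →
    (∀ x → ¬ (x ≈ 0#) → eval m p x ≈ eval m q x) → p ≐ q
  identity-theorem m {p} {q} deg-p deg-q agree k with k ℕ.≤? m
  ... | yes k≤m = x-y≈0⇒x≈y _ _ (trans (solve 2 (λ a b → a :- b := a :- 𝟙 :* b) refl (p k) (q k))
    (vanishing-coefficients m (p -[ 1# ] q) (λ x x≉0 → trans (eval-linear m p 1# q x)
      (trans (solve 2 (λ a b → a :- 𝟙 :* b := a :- b) refl _ _) (x≈y⇒x-y≈0 (agree x x≉0)))) k k≤m))
  ... | no  k≰m = trans (deg-p k (ℕ.≰⇒> k≰m)) (sym (deg-q k (ℕ.≰⇒> k≰m)))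

  -- The root is the supremum `s` of the points below `w` with negative value: a negative value at
  -- `s` would persist to its right, and a positive one would make `s - δ` an upper bound.
  intermediate-value : ∀ m p {u w} → u < w → eval m p u < 0# → 0# < eval m p w →
    ∃ λ a → u < a × a < w × eval m p a ≈ 0#
  intermediate-value m p {u} {w} u<w pu<0 0<pw
    -- `Lift` brings the predicate to the universe level at which `supremum` is stated.
    with supremum (λ x → Lift (c ⊔ ℓ₁) (x < w × eval m p x < 0#)) (u , lift (u<w , pu<0))
           (w , λ x Px → inj₁ (proj₁ (lower Px)))
  ... | s , upper , least = s , ≤∧≉⇒< (upper u (lift (u<w , pu<0))) u≉s , ≤∧≉⇒< s≤w s≉w , ps≈0
    where
    s≤w : s ≤ w
    s≤w = least w λ x Px → inj₁ (proj₁ (lower Px))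
    ps≮0 : ¬ (eval m p s < 0#)
    ps≮0 ps<0 =
      let δ , 0<δ , near = eval-negative-near m p s ps<0
          h , 0<h , h<δ , h<w-s = below-both 0<δ (x<y⇒0<y-x (≤∧≉⇒< s≤w λ s≈w →
            <⇒≱ 0<pw (inj₁ (<-respˡ (eval-cong m (λ _ → refl) s≈w) ps<0))))
          s<s+h = 0<y-x⇒x<y (<-respʳ (solve 2 (λ s h → h := (s :+ h) :- s) refl s h) 0<h)
          s+h<w = 0<y-x⇒x<y (<-respʳ (solve 3 (λ s h w → (w :- s) :- h := w :- (s :+ h))
                refl s h w) (x<y⇒0<y-x h<w-s))
      in <⇒≱ s<s+h (upper (s + h) (lift (s+h<w , near h (inj₁ (x<y⇒0<y-x h<δ) , inj₁ (+-pos 0<δ 0<h)))))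
    ps≯0 : ¬ (0# < eval m p s)
    ps≯0 0<ps with eval-positive-near m p s 0<ps
    ... | δ , 0<δ , near = <⇒≱ s-δ<s (least (s - δ) bound)
      where
      s-δ<s : s - δ < s
      s-δ<s = 0<y-x⇒x<y (<-respʳ (solve 2 (λ s δ → δ := s :- (s :- δ)) refl s δ) 0<δ)
      bound : ∀ x → Lift (c ⊔ ℓ₁) (x < w × eval m p x < 0#) → x ≤ s - δ
      bound x (lift (x<w , px<0)) = ≮⇒≥ λ s-δ<x → <⇒≱ px<0 (inj₁ (<-respʳ
        (eval-cong m (λ _ → refl) (solve 2 (λ s x → s :+ (x :- s) := x) refl s x))
        (near (x - s)
          ( 0≤-resp (solve 3 (λ δ s x → δ :+ (s :- x) := δ :- (x :- s)) refl δ s x)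
              (+-nonneg (inj₁ 0<δ) (x≤y⇒0≤y-x (upper x (lift (x<w , px<0)))))
          , 0≤-resp (solve 3 (λ δ s x → x :- (s :- δ) := δ :+ (x :- s)) refl δ s x) (inj₁ (x<y⇒0<y-x s-δ<x))))))
    ps≈0 : eval m p s ≈ 0#
    ps≈0 with compare (eval m p s) 0#
    ... | tri< ps<0 _ _ = ⊥-elim (ps≮0 ps<0)
    ... | tri≈ _ ps≈0 _ = ps≈0
    ... | tri> _ _ 0<ps = ⊥-elim (ps≯0 0<ps)
    u≉s : ¬ (u ≈ s)
    u≉s u≈s = x<y⇒x≉y pu<0 (trans (eval-cong m (λ _ → refl) u≈s) ps≈0)
    s≉w : ¬ (s ≈ w)
    s≉w s≈w = pos⇒≉0 0<pw (trans (eval-cong m (λ _ → refl) (sym s≈w)) ps≈0)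

  -- Multiplicities of common roots

  -- (X - t)^k divides p, a monic polynomial of degree m.
  Multiplicity≥ : ℕ → Carrier → ℕ → Coefficients → Set ℓ₁
  Multiplicity≥ zero    t m       p = ⊤
  Multiplicity≥ (suc k) t zero    p = ⊥
  Multiplicity≥ (suc k) t (suc m) p = eval (suc m) p t ≈ 0# × Multiplicity≥ k t m (p /[X- t ])

  mult-cong : ∀ k {s t} m {p q} → s ≈ t → p ≐ q → Multiplicity≥ k s m p → Multiplicity≥ k t m q
  mult-cong zero    m       s≈t p≐q _             = tt
  mult-cong (suc k) (suc m) s≈t p≐q (root , mult) =
    trans (eval-cong (suc m) (≐-sym p≐q) (sym s≈t)) root , mult-cong k m s≈t (/[X-]-cong s≈t p≐q) mult

  mult-weaken : ∀ k {t} m {p} → Multiplicity≥ (suc k) t m p → Multiplicity≥ k t m p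
  mult-weaken zero    m       _             = tt
  mult-weaken (suc k) (suc m) (root , mult) = root , mult-weaken k m mult

  mult-[X-] : ∀ k {s} t m {p} → Monic m p → Multiplicity≥ k s m p → Multiplicity≥ k s (suc m) (p [X- t ])
  mult-[X-] zero    t m       mon _             = tt
  mult-[X-] (suc k) {s} t (suc m) {p} mon (root , mult) =
      trans (eval-[X-]-degree (suc m) t s (degree mon)) (trans (*-congˡ root) (zeroʳ _))
    , mult-cong k (suc m) refl (≐-sym ([X-]-/[X-]-comm p s t)) (mult-[X-] k t m (/[X-]-monic mon root) mult)

  monic-leading≉0 : ∀ {m p} → Monic m p → ¬ (p 0 ≈ 0#)
  monic-leading≉0 mon root = 0≉1 (trans (sym root) (leading mon))

  -- Since `s - t` is nonzero, a root `s` of `(X - t) p` is a root of `p`; division by `X - s`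
  -- commutes with the factor `X - t`, so the argument repeats.
  mult-[X-]⁻ : ∀ k {s} t m {p} → ¬ (s ≈ t) → Monic m p →
    Multiplicity≥ k s (suc m) (p [X- t ]) → Multiplicity≥ k s m p
  mult-[X-]⁻ zero    t m s≉t mon _ = tt
  mult-[X-]⁻ (suc k) {s} t m {p} s≉t mon (root′ , mult) = go m mon mult
      (x*y≈0⇒y≈0 (λ s-t≈0 → s≉t (x-y≈0⇒x≈y s t s-t≈0)) (trans (sym (eval-[X-]-degree m t s (degree mon))) root′))
    where
    go : ∀ m → Monic m p → Multiplicity≥ k s m ((p [X- t ]) /[X- s ]) → eval m p s ≈ 0# → Multiplicity≥ (suc k) s m p
    go zero    mon mult root = ⊥-elim (monic-leading≉0 mon root)
    go (suc m) mon mult root = root , mult-[X-]⁻ k t m s≉t (/[X-]-monic mon root)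
      (mult-cong k (suc m) refl ([X-]-/[X-]-comm p s t) mult)

  shift-[X-] : ∀ p t → shift (p [X- t ]) ≐ shift p [X- t ]
  shift-[X-] p t zero          = refl
  shift-[X-] p t (suc zero)    = solve 2 (λ a t → a := a :- t :* 𝟘) refl (p 0) t
  shift-[X-] p t (suc (suc k)) = refl

  shift-cong : ∀ {p q} → p ≐ q → shift p ≐ shift q
  shift-cong p≐q zero    = refl
  shift-cong p≐q (suc k) = p≐q k

  [X-]-linear : ∀ p s q t → (p -[ s ] q) [X- t ] ≐ (p [X- t ]) -[ s ] (q [X- t ])
  [X-]-linear p s q t zero    = refl
  [X-]-linear p s q t (suc k) = solve 6 (λ a b a′ b′ s t →
      (a :- s :* b) :- t :* (a′ :- s :* b′) := (a :- t :* a′) :- s :* (b :- t :* b′))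
    refl (p (suc k)) (q (suc k)) (p k) (q k) s t

  -- If q = (X - t)^j b and θ q = (X - t)^j p, then the product rule for θ gives
  -- the relation assumed here, with α = j t.
  mult-quotient : ∀ k m {t α p b} → 0# < t → 0# < α → Monic m p → Monic m b →
    p [X- t ] ≐ (θ b [X- t ]) -[ α ] shift b → Multiplicity≥ k t m p → Multiplicity≥ (suc k) t m b
  mult-quotient k m {t} {α} {p} {b} 0<t 0<α mon-p mon-b rel mult = go k m mon-p mon-b mult root
    where
    -- Evaluating `rel` at `t` kills both terms with a factor `X - t`.
    α-root : α * eval m b t ≈ 0#
    α-root = begin
      α * eval m b t
        ≈⟨ solve 3 (λ t e r → r := (t :- t) :* e :- ((t :- t) :* e :- r))
              refl t (eval m (θ b) t) (α * eval m b t) ⟩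
      (t - t) * eval m (θ b) t - ((t - t) * eval m (θ b) t - α * eval m b t)
        ≈⟨ +-congˡ (-‿cong (+-cong (eval-[X-]-degree m t t (θ-degree (degree mon-b))) (-‿cong (*-congˡ (eval-shift m b t))))) ⟨
      (t - t) * eval m (θ b) t - (eval (suc m) (θ b [X- t ]) t - α * eval (suc m) (shift b) t)
        ≈⟨ +-congˡ (-‿cong (eval-linear (suc m) (θ b [X- t ]) α (shift b) t)) ⟨
      (t - t) * eval m (θ b) t - eval (suc m) ((θ b [X- t ]) -[ α ] shift b) t
        ≈⟨ +-congˡ (-‿cong (eval-cong (suc m) rel refl)) ⟨
      (t - t) * eval m (θ b) t - eval (suc m) (p [X- t ]) t
        ≈⟨ +-congˡ (-‿cong (eval-[X-]-degree m t t (degree mon-p))) ⟩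
      (t - t) * eval m (θ b) t - (t - t) * eval m p t
        ≈⟨ solve 3 (λ t a b → (t :- t) :* a :- (t :- t) :* b := 𝟘) refl t _ _ ⟩
      0# ∎
    root : eval m b t ≈ 0#
    root = x*y≈0⇒y≈0 (pos⇒≉0 0<α) α-root
    p′ b′ : Coefficients
    p′ = p /[X- t ]
    b′ = b /[X- t ]
    θb : θ b ≐ (θ b′ [X- t ]) -[ t ] shift b′
    θb = ≐-trans (θ-cong (≐-sym (/[X-]-[X-] b t))) (θ-[X-] b′ t)
    combine : ((θ b′ [X- t ]) -[ t ] shift b′) -[ α ] shift b′ ≐ (θ b′ [X- t ]) -[ α + t ] shift b′
    combine i = solve 4 (λ x y t α → (x :- t :* y) :- α :* y := x :- (α :+ t) :* y)
          refl ((θ b′ [X- t ]) i) (shift b′ i) t α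
    -- Writing `p` and `b` as multiples of `X - t` and cancelling one factor reproduces `rel` for
    -- the quotients; `θ b` contributes one further `t`, which turns `j t` into `(j + 1) t`.
    rel′ : p′ [X- t ] ≐ (θ b′ [X- t ]) -[ α + t ] shift b′
    rel′ = [X-]-injective t λ i → begin
      ((p′ [X- t ]) [X- t ]) i                                            ≈⟨ [X-]-cong t (/[X-]-[X-] p t) i ⟩
      (p [X- t ]) i                                                       ≈⟨ rel i ⟩
      ((θ b [X- t ]) -[ α ] shift b) i
        ≈⟨ +-cong ([X-]-cong t θb i) (-‿cong (*-congˡ (trans (shift-cong (≐-sym (/[X-]-[X-] b t)) i) (shift-[X-] b′ t i)))) ⟩
      ((((θ b′ [X- t ]) -[ t ] shift b′) [X- t ]) -[ α ] (shift b′ [X- t ])) i ≈⟨ [X-]-linear _ α (shift b′) t i ⟨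
      ((((θ b′ [X- t ]) -[ t ] shift b′) -[ α ] shift b′) [X- t ]) i      ≈⟨ [X-]-cong t combine i ⟩
      (((θ b′ [X- t ]) -[ α + t ] shift b′) [X- t ]) i                    ∎
    go : ∀ k m → Monic m p → Monic m b → Multiplicity≥ k t m p → eval m b t ≈ 0# → Multiplicity≥ (suc k) t m b
    go k       zero    mon-p mon-b mult root = ⊥-elim (monic-leading≉0 mon-b root)
    go zero    (suc m) mon-p mon-b mult root = root , tt
    go (suc k) (suc m) mon-p mon-b (root-p , mult) root = root ,
      mult-quotient k m 0<t (+-pos 0<α 0<t) (/[X-]-monic mon-p root-p) (/[X-]-monic mon-b root) rel′ mult

  -- For `q = (X - t) b` the relation of `mult-quotient` holds with `α = t`. The outcome is one
  -- order more in `q` than in `p`; `mult-weaken` gives up the surplus.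
  mult-θ : ∀ k m {t p q} → 0# < t → Monic m p → Monic m q → p ≐ θ q → eval m q t ≈ 0# →
    Multiplicity≥ k t m p → Multiplicity≥ k t m q
  mult-θ zero    m       0<t mon-p mon-q p≐θq root _               = tt
  mult-θ (suc k) (suc m) {t} {p} {q} 0<t mon-p mon-q p≐θq root (root-p , mult) = root , mult-weaken k m
    (mult-quotient k m 0<t 0<t (/[X-]-monic mon-p root-p) (/[X-]-monic mon-q root)
      (≐-trans (/[X-]-[X-] p t) (≐-trans p≐θq (≐-trans (θ-cong (≐-sym (/[X-]-[X-] q t))) (θ-[X-] (q /[X- t ]) t)))) mult)

  -- Splitting polynomials with alternating signs

  -- The bound `u < t` lets the property survive the removal of a root of `q` found between roots of
  -- `p`: raising `u` past that root takes it out of the comparison.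
  InheritsMultiplicities : Carrier → ℕ → Coefficients → Coefficients → Set _
  InheritsMultiplicities u m p q =
    ∀ t → u < t → ∀ k → Multiplicity≥ k t m p → eval m q t ≈ 0# → Multiplicity≥ k t m q

  eval-root : ∀ m {p a} x → Monic (suc m) p → eval (suc m) p a ≈ 0# →
    eval (suc m) p x ≈ (x - a) * eval m (p /[X- a ]) x
  eval-root m {p} {a} x mon root = trans (eval-divided m p a x) (trans (+-congˡ root) (+-identityʳ _))

  quotient-sign : ∀ s m {p a x} → Monic (suc m) p → eval (suc m) p a ≈ 0# → a < x →
    0# ≤ s * eval (suc m) p x → 0# ≤ s * eval m (p /[X- a ]) x
  quotient-sign s m {p} {a} {x} mon root a<x 0≤ = *-nonneg-cancelˡ (x<y⇒0<y-x a<x) (0≤-resp (begin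
    s * eval (suc m) p x                     ≈⟨ *-congˡ (eval-root m x mon root) ⟩
    s * ((x - a) * eval m (p /[X- a ]) x)    ≈⟨ solve 3 (λ s y e → s :* (y :* e) := y :* (s :* e))
          refl s (x - a) _ ⟩
    (x - a) * (s * eval m (p /[X- a ]) x)    ∎) 0≤)

  quotient-inherits : ∀ {u} m {v : Vector Carrier (suc m)} {p a} → Monic (suc m) p → eval (suc m) p a ≈ 0# →
    InheritsMultiplicities u (suc m) ∏[X- v ] p →
    ∀ t → u < t → ¬ (t ≈ a) → ∀ k → Multiplicity≥ k t m ∏[X- v ∘ Fin.suc ] →
    eval m (p /[X- a ]) t ≈ 0# → Multiplicity≥ k t m (p /[X- a ])
  quotient-inherits m {v} {p} {a} mon root inherits t u<t t≉a k mult root′ =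
    mult-[X-]⁻ k a m t≉a (/[X-]-monic mon root) (mult-cong k (suc m) refl (≐-sym (/[X-]-[X-] p a))
      (inherits t u<t k (mult-[X-] k (v Fin.zero) m (∏-monic (v ∘ Fin.suc)) mult)
        (trans (eval-root m t mon root) (trans (*-congˡ root′) (zeroʳ _)))))

  -- Induction on the degree, with `l` the smallest entry of `v`. If `p(l) = 0`, the factor `X - l`
  -- leaves both `p` and `∏[X- v ]`. Otherwise `p` has opposite signs at `u` and `l`; a root `a`
  -- between them leaves `p`, `X - l` leaves `∏[X- v ]`, and the base point moves up to `l`. The
  -- removed factor of `p` is positive at all larger entries, so the signs there persist.
  splits : ∀ m u (v : Vector Carrier m) p → Monic m p → Nondecreasing v → (∀ i → u < v i) →
    0# < sgn m * eval m p u → (∀ i → 0# ≤ sgn (after i) * eval m p (v i)) →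
    InheritsMultiplicities u m ∏[X- v ] p →
    ∃ λ (a : Vector Carrier m) → (∀ i → u < a i) × p ≐ ∏[X- a ]
  splits zero u v p mon mono u<v sign-u signs inherits =
    (λ ()) , (λ ()) , λ { zero → leading mon ; (suc k) → degree mon (suc k) (ℕ.s≤s ℕ.z≤n) }
  splits (suc m) u v p mon mono u<v sign-u signs inherits = result (eval (suc m) p l ≟ 0#)
    where
    l : Carrier
    l = v Fin.zero
    vs : Vector Carrier m
    vs = v ∘ Fin.suc
    extend : ∀ {a u′} → u < a → u ≤ u′ → p ≐ (p /[X- a ]) [X- a ] →
      (∃ λ (as : Vector Carrier m) → (∀ i → u′ < as i) × p /[X- a ] ≐ ∏[X- as ]) →
      ∃ λ (as : Vector Carrier (suc m)) → (∀ i → u < as i) × p ≐ ∏[X- as ]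
    extend {a} u<a u≤u′ p≐ (as , u′<as , q≐) = a Vector.∷ as
      , (λ { Fin.zero → u<a ; (Fin.suc i) → ≤-<-trans u≤u′ (u′<as i) })
      , ≐-trans p≐ ([X-]-cong a q≐)
      where
      ≤-<-trans : ∀ {x y z} → x ≤ y → y < z → x < z
      ≤-<-trans (inj₁ x<y) y<z = <-trans x<y y<z
      ≤-<-trans (inj₂ x≈y) y<z = <-respˡ (sym x≈y) y<z

    module Root (root : eval (suc m) p l ≈ 0#) where
      q : Coefficients
      q = p /[X- l ]
      -- Order `k` in `∏[X- vs ]` is order `k + 1` in `∏[X- v ]`, hence in `p`, hence order `k` in
      -- `q`.
      mult-head : ∀ k → Multiplicity≥ k l m ∏[X- vs ] → Multiplicity≥ k l m q
      mult-head k mult = proj₂ (inherits l (u<v Fin.zero) (suc k)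
        (eval-∏-root v Fin.zero , mult-cong k m refl (≐-sym ([X-]-/[X-] ∏[X- vs ] l)) mult) root)
      sign-u′ : 0# < sgn m * eval m q u
      sign-u′ = *-pos-cancelˡ (x<y⇒0<y-x (u<v Fin.zero)) (<-respʳ (begin
        sgn (suc m) * eval (suc m) p u       ≈⟨ *-congˡ (eval-root m u mon root) ⟩
        sgn (suc m) * ((u - l) * eval m q u) ≈⟨ solve 4 (λ s u l e → (:- 𝟙 :* s) :* ((u :- l) :* e) := (l :- u) :* (s :* e))
                                                refl (sgn m) u l (eval m q u) ⟩
        (l - u) * (sgn m * eval m q u)       ∎) sign-u)
      -- If `l` recurs among the other entries, `q` vanishes at `l` again, and the sign required
      -- there holds as an equality. The length is a variable so that `i` can force it to be a
      -- successor.
      double : ∀ {n} (w : Vector Carrier n) i → l ≈ w i →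
        (∀ k → Multiplicity≥ k l n ∏[X- w ] → Multiplicity≥ k l n q) → eval n q l ≈ 0#
      double {suc n} w i l≈wᵢ lift-mult =
        proj₁ (lift-mult 1 (trans (eval-cong (suc n) (λ _ → refl) l≈wᵢ) (eval-∏-root w i) , tt))
      signs′ : ∀ i → 0# ≤ sgn (after i) * eval m q (vs i)
      signs′ i with mono Fin.zero (Fin.suc i) ℕ.z≤n
      ... | inj₁ l<vᵢ = quotient-sign (sgn (after i)) m mon root l<vᵢ (signs (Fin.suc i))
      ... | inj₂ l≈vᵢ = inj₂ (sym (trans (*-congˡ (trans
        (eval-cong m (λ _ → refl) (sym l≈vᵢ)) (double vs i l≈vᵢ mult-head))) (zeroʳ _)))
      inherits′ : InheritsMultiplicities u m ∏[X- vs ] q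
      inherits′ t u<t k mult root′ with t ≟ l
      ... | yes t≈l = mult-cong k m (sym t≈l) (λ _ → refl) (mult-head k (mult-cong k m t≈l (λ _ → refl) mult))
      ... | no  t≉l = quotient-inherits m {v} mon root inherits t u<t t≉l k mult root′

    module NonRoot (nonroot : ¬ (eval (suc m) p l ≈ 0#)) where
      sgn-cancel-≈0 : ∀ {x} → sgn m * x ≈ 0# → x ≈ 0#
      sgn-cancel-≈0 {x} sx≈0 = trans (sym (sgn-cancel m x)) (trans (*-congˡ sx≈0) (zeroʳ _))
      sign-l : 0# < sgn m * eval (suc m) p l
      sign-l = ≤∧≉⇒< (signs Fin.zero) λ 0≈ → nonroot (sgn-cancel-≈0 (sym 0≈))
      scaled : Coefficients
      scaled k = sgn m * p k
      ivt : ∃ λ a → u < a × a < l × eval (suc m) scaled a ≈ 0#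
      ivt = intermediate-value (suc m) scaled (u<v Fin.zero)
        (<-respˡ (trans (solve 2 (λ s e → :- ((:- 𝟙 :* s) :* e) := s :* e) refl (sgn m) _)
                        (sym (eval-scale (suc m) (sgn m) p u))) (-‿neg sign-u))
        (<-respʳ (sym (eval-scale (suc m) (sgn m) p l)) sign-l)
      a : Carrier
      a = proj₁ ivt
      u<a : u < a
      u<a = proj₁ (proj₂ ivt)
      a<l : a < l
      a<l = proj₁ (proj₂ (proj₂ ivt))
      root : eval (suc m) p a ≈ 0#
      root = sgn-cancel-≈0 (trans (sym (eval-scale (suc m) (sgn m) p a)) (proj₂ (proj₂ (proj₂ ivt))))
      q : Coefficients
      q = p /[X- a ]
      -- If the next entry equalled `l`, its sign condition would require of `p(l)` the sign
      -- opposite to `sign-l`.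
      simple : ∀ i → l < vs i
      simple = go m vs (λ i → mono Fin.zero (Fin.suc i) ℕ.z≤n) (tail-nondecreasing mono) (signs ∘ Fin.suc) sign-l
        where
        go : ∀ n (w : Vector Carrier n) → (∀ i → l ≤ w i) → Nondecreasing w →
          (∀ i → 0# ≤ sgn (after i) * eval (suc m) p (w i)) → 0# < sgn n * eval (suc m) p l → ∀ i → l < w i
        go (suc n) w l≤w mono signs sign-l i = <-≤-trans (≤∧≉⇒< (l≤w Fin.zero) λ l≈w₀ →
          <⇒≱ sign-l (0≤-x⇒x≤0 (0≤-resp (trans (*-congˡ (eval-cong (suc m) (λ _ → refl) (sym l≈w₀)))
            (solve 2 (λ s e → s :* e := :- ((:- 𝟙 :* s) :* e)) refl (sgn n) _)) (signs Fin.zero))))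
          (mono Fin.zero i ℕ.z≤n)
      sign-l′ : 0# < sgn m * eval m q l
      sign-l′ = ≤∧≉⇒< (quotient-sign (sgn m) m mon root a<l (inj₁ sign-l)) λ 0≈ → nonroot (begin
        eval (suc m) p l          ≈⟨ eval-root m l mon root ⟩
        (l - a) * eval m q l      ≈⟨ *-congˡ (sgn-cancel-≈0 (sym 0≈)) ⟩
        (l - a) * 0#              ≈⟨ zeroʳ _ ⟩
        0#                        ∎)

    result : Dec (eval (suc m) p l ≈ 0#) → ∃ λ (as : Vector Carrier (suc m)) → (∀ i → u < as i) × p ≐ ∏[X- as ]
    result (yes root) = extend (u<v Fin.zero) (inj₂ refl) (≐-sym (/[X-]-[X-] p l))
      (splits m u vs q (/[X-]-monic mon root) (tail-nondecreasing mono) (u<v ∘ Fin.suc) sign-u′ signs′ inherits′)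
      where open Root root
    result (no nonroot) = extend u<a (inj₁ (u<v Fin.zero)) (≐-sym (/[X-]-[X-] p a))
      (splits m l vs q (/[X-]-monic mon root) (tail-nondecreasing mono) simple sign-l′
        (λ i → quotient-sign (sgn (after i)) m mon root (<-trans a<l (simple i)) (signs (Fin.suc i)))
        (λ t l<t → quotient-inherits m {v} mon root inherits t (<-trans (u<v Fin.zero) l<t)
                     (λ t≈a → <-irrefl (sym t≈a) (<-trans a<l l<t))))
      where open NonRoot nonroot

  -- The sign at the largest root

  -- For p of degree m, θ⁻¹ p at t is the mean of s^m p(t/s) over s in [0, 1],
  -- hence nonnegative when all roots of p lie in [0, t].  Algebraically: by
  -- t (X - l) = (t - l) X + l (X - t) it is enough to know θ⁻¹ (X - t)^k at t.
  _[X-_]^_ : Coefficients → Carrier → ℕ → Coefficients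
  p [X- t ]^ zero  = p
  p [X- t ]^ suc k = (p [X- t ]^ k) [X- t ]

  θ⁻¹-cong : ∀ {p q} → p ≐ q → θ⁻¹ p ≐ θ⁻¹ q
  θ⁻¹-cong p≐q k = *-congʳ (p≐q k)

  θ⁻¹-degree : ∀ {m p} → Degree≤ m p → Degree≤ m (θ⁻¹ p)
  θ⁻¹-degree deg k m<k = trans (*-congʳ (deg k m<k)) (zeroˡ _)

  []^-[X-] : ∀ p l t k → (p [X- l ]) [X- t ]^ k ≐ (p [X- t ]^ k) [X- l ]
  []^-[X-] p l t zero    = λ _ → refl
  []^-[X-] p l t (suc k) = ≐-trans ([X-]-cong t ([]^-[X-] p l t k)) ([X-]-comm (p [X- t ]^ k) l t)

  []^-degree : ∀ {m p} t k → Degree≤ m p → Degree≤ (k ℕ.+ m) (p [X- t ]^ k)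
  []^-degree t zero    deg = deg
  []^-degree t (suc k) deg = [X-]-degree t ([]^-degree t k deg)

  eval-degree : ∀ m {p} x → Degree≤ m p → eval (suc m) p x ≈ x * eval m p x
  eval-degree m x deg = trans (+-congʳ (deg (suc m) ℕ.≤-refl)) (+-identityˡ _)

  -- `ℕ.pred` sends `0` to `0`; the value chosen there is harmless, because this power only enters
  -- with the coefficient `k`.
  pred-power : Carrier → ℕ → Coefficients
  pred-power t k = one [X- t ]^ (ℕ.pred k)

  -- This is `(k + 1) (X - t)^k - k X (X - t)^(k - 1)`: reading `pred-power t k` in formal degree
  -- `k` supplies the factor `X`.
  θ-power : ∀ t k i →
    θ (one [X- t ]^ k) i ≈ (suc k · 1#) * (one [X- t ]^ k) i - (k · 1#) * pred-power t k i
  θ-power t zero zero = solve 1 (λ a → (𝟙 :+ 𝟘) :* a := (𝟙 :+ 𝟘) :* a :- 𝟘 :* a) refl 1#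
  θ-power t zero (suc i) = solve 1 (λ n → n :* 𝟘 := (𝟙 :+ 𝟘) :* 𝟘 :- 𝟘 :* 𝟘) refl (suc (suc i) · 1#)
  θ-power t (suc k) zero = solve 2 (λ a k → (𝟙 :+ 𝟘) :* a := (𝟙 :+ (𝟙 :+ k)) :* a :- (𝟙 :+ k) :* a)
    refl ((one [X- t ]^ k) 0) (k · 1#)
  θ-power t (suc k) (suc i) = begin
    (1# + I) * (b - t * a)
      ≈⟨ solve 4 (λ I b a t → (𝟙 :+ I) :* (b :- t :* a) := (𝟙 :+ I) :* b :- t :* (I :* a :+ a)) refl I b a t ⟩
    (1# + I) * b - t * (I * a + a)
      ≈⟨ +-cong (θ-power t k (suc i)) (-‿cong (*-congˡ (+-congʳ (θ-power t k i)))) ⟩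
    ((1# + K) * b - K * b₁) - t * (((1# + K) * a - K * a₁) + a)
      ≈⟨ solve 6 (λ K b b₁ t a a₁ → ((𝟙 :+ K) :* b :- K :* b₁) :- t :* (((𝟙 :+ K) :* a :- K :* a₁) :+ a)
           := ((𝟙 :+ K) :* b :- K :* (b₁ :- t :* a₁)) :- t :* ((𝟙 :+ K) :* a :+ a)) refl K b b₁ t a a₁ ⟩
    ((1# + K) * b - K * (b₁ - t * a₁)) - t * ((1# + K) * a + a)
      ≈⟨ +-congʳ (+-congˡ (-‿cong (previous k))) ⟩
    ((1# + K) * b - K * b) - t * ((1# + K) * a + a)
      ≈⟨ solve 4 (λ K b t a → ((𝟙 :+ K) :* b :- K :* b) :- t :* ((𝟙 :+ K) :* a :+ a)
           := (𝟙 :+ (𝟙 :+ K)) :* (b :- t :* a) :- (𝟙 :+ K) :* b) refl K b t a ⟩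
    (1# + (1# + K)) * (b - t * a) - (1# + K) * b ∎
    where
    I  = suc i · 1#
    K  = k · 1#
    a  = (one [X- t ]^ k) i
    b  = (one [X- t ]^ k) (suc i)
    a₁ = pred-power t k i
    b₁ = pred-power t k (suc i)
    previous : ∀ k → (k · 1#) * (pred-power t k (suc i) - t * pred-power t k i) ≈ (k · 1#) * (one [X- t ]^ k) (suc i)
    previous zero    = trans (zeroˡ _) (sym (zeroˡ _))
    previous (suc k) = refl

  θ⁻¹-power : ∀ t k →
    one [X- t ]^ k ≐ (λ i → (suc k · 1#) * θ⁻¹ (one [X- t ]^ k) i) -[ k · 1# ] θ⁻¹ (pred-power t k)
  θ⁻¹-power t k i = begin
    p i                                     ≈⟨ θ-θ⁻¹ p i ⟨
    n * (p i * n ⁻¹)                        ≈⟨ *-assoc n _ _ ⟨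
    θ p i * n ⁻¹                            ≈⟨ *-congʳ (θ-power t k i) ⟩
    ((1# + K) * p i - K * p₁ i) * n ⁻¹      ≈⟨ solve 4 (λ K p p₁ i → ((𝟙 :+ K) :* p :- K :* p₁) :* i
                                                 := (𝟙 :+ K) :* (p :* i) :- K :* (p₁ :* i)) refl K (p i) (p₁ i) (n ⁻¹) ⟩
    (1# + K) * (p i * n ⁻¹) - K * (p₁ i * n ⁻¹) ∎
    where
    K  = k · 1#
    n  = suc i · 1#
    p  = one [X- t ]^ k
    p₁ = pred-power t k

  module _ {t} (0<t : 0# < t) where

    ·1-nonneg : ∀ k → 0# ≤ k · 1#
    ·1-nonneg zero    = inj₂ refl
    ·1-nonneg (suc k) = inj₁ (suc·1-pos k)

    one-degree : ∀ k → Degree≤ k (one [X- t ]^ k)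
    one-degree k = ≡.subst (λ n → Degree≤ n (one [X- t ]^ k)) (ℕ.+-identityʳ k) ([]^-degree t k (degree one-monic))

    -- At `t` the left side of `θ⁻¹-power` vanishes for positive exponents, so `k + 2` times the
    -- value for `k + 1` is `(k + 1) t` times the value for `k`. The value is thus `t^k / (k + 1)`.
    θ⁻¹-power-nonneg : ∀ k → 0# ≤ eval k (θ⁻¹ (one [X- t ]^ k)) t
    θ⁻¹-power-nonneg zero    = inj₁ (*-pos 0<1 (⁻¹-pos (suc·1-pos 0)))
    θ⁻¹-power-nonneg (suc k) = *-nonneg-cancelˡ (suc·1-pos (suc k)) (0≤-resp (sym recurrence)
      (*-nonneg (·1-nonneg (suc k)) (*-nonneg (inj₁ 0<t) (θ⁻¹-power-nonneg k))))
      where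
      p  = one [X- t ]^ k
      N  = suc (suc k) · 1#
      K  = suc k · 1#
      w  = eval (suc k) (θ⁻¹ (p [X- t ])) t
      w₁ = eval (suc k) (θ⁻¹ p) t
      root : N * w - K * w₁ ≈ 0#
      root = begin
        N * w - K * w₁
          ≈⟨ +-congʳ (eval-scale (suc k) N (θ⁻¹ (p [X- t ])) t) ⟨
        eval (suc k) (λ i → N * θ⁻¹ (p [X- t ]) i) t - K * w₁
          ≈⟨ eval-linear (suc k) (λ i → N * θ⁻¹ (p [X- t ]) i) K (θ⁻¹ p) t ⟨
        eval (suc k) ((λ i → N * θ⁻¹ (p [X- t ]) i) -[ K ] θ⁻¹ p) t
          ≈⟨ eval-cong (suc k) (θ⁻¹-power t (suc k)) refl ⟨
        eval (suc k) (p [X- t ]) t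
          ≈⟨ eval-[X-]-degree k t t (one-degree k) ⟩
        (t - t) * eval k p t
          ≈⟨ solve 2 (λ t e → (t :- t) :* e := 𝟘) refl t _ ⟩
        0# ∎
      recurrence : N * w ≈ K * (t * eval k (θ⁻¹ p) t)
      recurrence = trans (x-y≈0⇒x≈y _ _ root) (*-congˡ (eval-degree k t (θ⁻¹-degree (one-degree k))))

    -- The powers of `X - t` strengthen the induction, since they arise when a factor `X - l` is
    -- rewritten through `X` and `X - t`. The final use is `k = 0`.
    NonnegativeMeans : ℕ → Coefficients → Set _
    NonnegativeMeans m p = ∀ k → 0# ≤ eval (k ℕ.+ m) (θ⁻¹ (p [X- t ]^ k)) t

    means-[X-] : ∀ m p l → Degree≤ m p → 0# ≤ l → l ≤ t → NonnegativeMeans m p → NonnegativeMeans (suc m) (p [X- l ])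
    means-[X-] m p l deg 0≤l l≤t means k = ≡.subst (λ n → 0# ≤ eval n (θ⁻¹ ((p [X- l ]) [X- t ]^ k)) t)
      (≡.sym (ℕ.+-suc k m))
      (*-nonneg-cancelˡ 0<t (0≤-resp (sym split)
        (+-nonneg (*-nonneg (x≤y⇒0≤y-x l≤t) (*-nonneg (inj₁ 0<t) (means k))) (*-nonneg 0≤l (means (suc k))))))
      where
      n = k ℕ.+ m
      q = p [X- t ]^ k
      deg-q : Degree≤ n q
      deg-q = []^-degree t k deg
      -- In formal degree `n + 1` the sequence of `q` already stands for `X q`, so no explicit
      -- factor `X` appears.
      mix : (λ i → t * θ⁻¹ (q [X- l ]) i) ≐ (λ i → (t - l) * θ⁻¹ q i) -[ - l ] θ⁻¹ (q [X- t ])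
      mix zero    = solve 4 (λ t l a i → t :* (a :* i) := (t :- l) :* (a :* i) :- (:- l) :* (a :* i))
            refl t l (q 0) _
      mix (suc j) = solve 5 (λ t l a b i → t :* ((a :- l :* b) :* i) := (t :- l) :* (a :* i) :- (:- l) :* ((a :- t :* b) :* i))
        refl t l (q (suc j)) (q j) _
      split : t * eval (suc n) (θ⁻¹ ((p [X- l ]) [X- t ]^ k)) t
            ≈ (t - l) * (t * eval n (θ⁻¹ q) t) + l * eval (suc n) (θ⁻¹ (q [X- t ])) t
      split = begin
        t * eval (suc n) (θ⁻¹ ((p [X- l ]) [X- t ]^ k)) t
          ≈⟨ *-congˡ (eval-cong (suc n) (θ⁻¹-cong ([]^-[X-] p l t k)) refl) ⟩
        t * eval (suc n) (θ⁻¹ (q [X- l ])) t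
          ≈⟨ eval-scale (suc n) t (θ⁻¹ (q [X- l ])) t ⟨
        eval (suc n) (λ i → t * θ⁻¹ (q [X- l ]) i) t
          ≈⟨ eval-cong (suc n) mix refl ⟩
        eval (suc n) ((λ i → (t - l) * θ⁻¹ q i) -[ - l ] θ⁻¹ (q [X- t ])) t
          ≈⟨ eval-linear (suc n) (λ i → (t - l) * θ⁻¹ q i) (- l) (θ⁻¹ (q [X- t ])) t ⟩
        eval (suc n) (λ i → (t - l) * θ⁻¹ q i) t - (- l) * eval (suc n) (θ⁻¹ (q [X- t ])) t
          ≈⟨ +-cong (trans (eval-scale (suc n) (t - l) (θ⁻¹ q) t) (*-congˡ (eval-degree n t (θ⁻¹-degree deg-q))))
                    (solve 2 (λ l e → :- (:- l :* e) := l :* e) refl l _) ⟩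
        (t - l) * (t * eval n (θ⁻¹ q) t) + l * eval (suc n) (θ⁻¹ (q [X- t ])) t ∎

    means-∏ : ∀ {m} (v : Vector Carrier m) → (∀ i → 0# ≤ v i) → (∀ i → v i ≤ t) → NonnegativeMeans m ∏[X- v ]
    means-∏ {zero}  v 0≤v v≤t k = ≡.subst (λ n → 0# ≤ eval n (θ⁻¹ (one [X- t ]^ k)) t)
      (≡.sym (ℕ.+-identityʳ k)) (θ⁻¹-power-nonneg k)
    means-∏ {suc m} v 0≤v v≤t = means-[X-] m ∏[X- v ∘ Fin.suc ] (v Fin.zero) (degree (∏-monic (v ∘ Fin.suc)))
      (0≤v Fin.zero) (v≤t Fin.zero) (means-∏ (v ∘ Fin.suc) (0≤v ∘ Fin.suc) (v≤t ∘ Fin.suc))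

  -- The Laplacian of a star

  sum-≈0 : ∀ {n} {v : Vector Carrier n} → (∀ i → v i ≈ 0#) → sum v ≈ 0#
  sum-≈0 {zero}  v≈0 = refl
  sum-≈0 {suc n} v≈0 = trans (+-cong (v≈0 Fin.zero) (sum-≈0 (v≈0 ∘ Fin.suc))) (+-identityˡ _)

  sum-scale : ∀ {n} s (v : Vector Carrier n) → sum (λ i → s * v i) ≈ s * sum v
  sum-scale s v = sym (*-distribˡ-sum s v)

  minor : ∀ {n} → Matrix (suc n) → Fin (suc n) → Matrix n
  minor M j i k = M (Fin.suc i) (punchIn j k)

  det-cong : ∀ {n} {M N : Matrix n} → (∀ i j → M i j ≈ N i j) → det M ≈ det N
  det-cong {zero}  M≈N = refl
  det-cong {suc n} M≈N = sum-cong-≋ λ j → *-cong (*-congˡ {x = sgn (toℕ j)} (M≈N Fin.zero j))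
    (det-cong λ i k → M≈N (Fin.suc i) (punchIn j k))

  cofactor : ∀ {n} → Matrix (suc n) → Fin (suc n) → Carrier
  cofactor M j = sgn (toℕ j) * M Fin.zero j * det (minor M j)

  cofactor-zero-entry : ∀ {n} (M : Matrix (suc n)) j → M Fin.zero j ≈ 0# → cofactor M j ≈ 0#
  cofactor-zero-entry M j M0j≈0 = trans (*-congʳ (trans (*-congˡ M0j≈0) (zeroʳ _))) (zeroˡ _)

  cofactor-zero-minor : ∀ {n} (M : Matrix (suc n)) j → det (minor M j) ≈ 0# → cofactor M j ≈ 0#
  cofactor-zero-minor M j minor≈0 = trans (*-congˡ minor≈0) (zeroʳ _)

  det-zero-column : ∀ {n} (M : Matrix (suc n)) → (∀ i → M i Fin.zero ≈ 0#) → det M ≈ 0#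
  det-zero-column {zero}  M col≈0 = sum-≈0 {v = cofactor M} λ { Fin.zero → cofactor-zero-entry M Fin.zero (col≈0 Fin.zero) }
  det-zero-column {suc n} M col≈0 = sum-≈0 {v = cofactor M} λ
    { Fin.zero    → cofactor-zero-entry M Fin.zero (col≈0 Fin.zero)
    ; (Fin.suc j) → cofactor-zero-minor M (Fin.suc j) (det-zero-column (minor M (Fin.suc j)) (col≈0 ∘ Fin.suc)) }

  diagonalMatrix : ∀ {n} → Vector Carrier n → Matrix n
  diagonalMatrix y Fin.zero    Fin.zero    = y Fin.zero
  diagonalMatrix y Fin.zero    (Fin.suc j) = 0#
  diagonalMatrix y (Fin.suc i) Fin.zero    = 0#
  diagonalMatrix y (Fin.suc i) (Fin.suc j) = diagonalMatrix (y ∘ Fin.suc) i j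

  det-diagonal : ∀ {n} (y : Vector Carrier n) → det (diagonalMatrix y) ≈ product y
  det-diagonal {zero}  y = refl
  det-diagonal {suc n} y = begin
    cofactor (diagonalMatrix y) Fin.zero + sum (cofactor (diagonalMatrix y) ∘ Fin.suc)
      ≈⟨ +-cong (*-cong (*-identityˡ _) (det-diagonal (y ∘ Fin.suc)))
                (sum-≈0 λ j → cofactor-zero-entry (diagonalMatrix y) (Fin.suc j) refl) ⟩
    product y + 0#   ≈⟨ +-identityʳ _ ⟩
    product y        ∎

  bordered : ∀ {n} → Carrier → Vector Carrier n → Vector Carrier n → Vector Carrier n → Matrix (suc n)
  bordered d r b y Fin.zero    Fin.zero    = d
  bordered d r b y Fin.zero    (Fin.suc j) = r j
  bordered d r b y (Fin.suc i) Fin.zero    = b i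
  bordered d r b y (Fin.suc i) (Fin.suc j) = diagonalMatrix y i j

  -- This is `b j ∏_{i ≠ j} y i`, by recursion so that no product has to omit an index.
  borderMinor : ∀ {n} → Vector Carrier n → Vector Carrier n → Fin n → Carrier
  borderMinor b y Fin.zero    = b Fin.zero * product (y ∘ Fin.suc)
  borderMinor b y (Fin.suc j) = y Fin.zero * borderMinor (b ∘ Fin.suc) (y ∘ Fin.suc) j

  det-borderMinor : ∀ {n} d r (b y : Vector Carrier n) j →
    det (minor (bordered d r b y) (Fin.suc j)) ≈ sgn (toℕ j) * borderMinor b y j
  det-borderMinor {suc n} d r b y Fin.zero = begin
    cofactor N Fin.zero + sum (cofactor N ∘ Fin.suc)
      ≈⟨ +-cong (*-cong (*-identityˡ _) (trans (det-cong {N = diagonalMatrix (y ∘ Fin.suc)} λ i k → refl) (det-diagonal (y ∘ Fin.suc))))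
                (sum-≈0 λ k → cofactor-zero-entry N (Fin.suc k) refl) ⟩
    borderMinor b y Fin.zero + 0#      ≈⟨ +-identityʳ _ ⟩
    borderMinor b y Fin.zero           ≈⟨ *-identityˡ _ ⟨
    1# * borderMinor b y Fin.zero      ∎
    where N = minor (bordered d r b y) (Fin.suc Fin.zero)
  det-borderMinor {suc (suc n)} d r b y (Fin.suc j) = begin
    cofactor N Fin.zero + (cofactor N (Fin.suc Fin.zero) + sum (λ k → cofactor N (Fin.suc (Fin.suc k))))
      -- The entry `b 0` contributes nothing: its minor keeps the first column of the diagonal block
      -- without that column's diagonal entry.
      ≈⟨ +-cong (cofactor-zero-minor N Fin.zero (det-zero-column (minor N Fin.zero) λ i → refl))
           (+-cong (*-congˡ (trans (det-cong minors) (det-borderMinor d (r ∘ Fin.suc) (b ∘ Fin.suc) (y ∘ Fin.suc) j)))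
                   (sum-≈0 λ k → cofactor-zero-entry N (Fin.suc (Fin.suc k)) refl)) ⟩
    0# + (sgn 1 * y Fin.zero * (sgn (toℕ j) * g) + 0#)
      ≈⟨ solve 3 (λ y s g → 𝟘 :+ ((:- 𝟙 :* 𝟙) :* y :* (s :* g) :+ 𝟘) := (:- 𝟙 :* s) :* (y :* g))
            refl (y Fin.zero) (sgn (toℕ j)) g ⟩
    sgn (suc (toℕ j)) * (y Fin.zero * g) ∎
    where
    N = minor (bordered d r b y) (Fin.suc (Fin.suc j))
    g = borderMinor (b ∘ Fin.suc) (y ∘ Fin.suc) j
    minors : ∀ i k → minor N (Fin.suc Fin.zero) i k
      ≈ minor (bordered d (r ∘ Fin.suc) (b ∘ Fin.suc) (y ∘ Fin.suc)) (Fin.suc j) i k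
    minors i Fin.zero    = refl
    minors i (Fin.suc k) = refl

  -- The determinant of an arrowhead matrix. The expansion sign `(-1)^(j + 1)` meets the `(-1)^j` of
  -- the minor, so every term is subtracted; unlike a Schur complement, this allows zero entries of
  -- `y`.
  det-bordered : ∀ {n} d r (b y : Vector Carrier n) →
    det (bordered d r b y) ≈ d * product y - sum (λ j → r j * borderMinor b y j)
  det-bordered d r b y = begin
    cofactor M Fin.zero + sum (cofactor M ∘ Fin.suc)
      ≈⟨ +-cong (*-cong (*-identityˡ d) (trans (det-cong {N = diagonalMatrix y} λ i k → refl) (det-diagonal y)))
                (trans (sum-cong-≋ terms) (sum-scale (- 1#) (λ j → r j * borderMinor b y j))) ⟩
    d * product y + - 1# * sum (λ j → r j * borderMinor b y j)
      ≈⟨ solve 2 (λ x s → x :+ :- 𝟙 :* s := x :- s) refl (d * product y) _ ⟩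
    d * product y - sum (λ j → r j * borderMinor b y j) ∎
    where
    M = bordered d r b y
    terms : ∀ j → cofactor M (Fin.suc j) ≈ - 1# * (r j * borderMinor b y j)
    terms j = begin
      sgn (suc (toℕ j)) * r j * det (minor M (Fin.suc j))
        ≈⟨ *-congˡ (det-borderMinor d r b y j) ⟩
      sgn (suc (toℕ j)) * r j * (s * g)
        ≈⟨ solve 3 (λ s r g → (:- 𝟙 :* s) :* r :* (s :* g) := :- 𝟙 :* (r :* (s :* (s :* g)))) refl s (r j) g ⟩
      - 1# * (r j * (s * (s * g)))
        ≈⟨ *-congˡ (*-congˡ (sgn-cancel (toℕ j) g)) ⟩
      - 1# * (r j * g) ∎
      where
      s = sgn (toℕ j)
      g = borderMinor b y j

  -- Expanding the star determinant gives X θ Q with Q = ∏ (X - aᵢ).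
  bordered-θ : ∀ {m} (a : Vector Carrier m) x →
    (x - sum a) * product (λ i → x - a i) - sum (λ j → a j * borderMinor a (λ i → x - a i) j)
      ≈ x * eval m (θ ∏[X- a ]) x
  bordered-θ {zero}  a x = solve 1 (λ x → (x :- 𝟘) :* 𝟙 :- 𝟘 := x :* ((𝟙 :+ 𝟘) :* 𝟙)) refl x
  bordered-θ {suc m} a x = begin
    (x - (a₀ + A)) * ((x - a₀) * Q) - (a₀ * (a₀ * Q) + sum (λ j → as j * ((x - a₀) * borderMinor as y j)))
      ≈⟨ +-congˡ (-‿cong (+-congˡ (trans
           (sum-cong-≋ λ j → solve 3 (λ a y g → a :* (y :* g) := y :* (a :* g))
                 refl (as j) (x - a₀) (borderMinor as y j))
           (sum-scale (x - a₀) λ j → as j * borderMinor as y j)))) ⟩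
    (x - (a₀ + A)) * ((x - a₀) * Q) - (a₀ * (a₀ * Q) + (x - a₀) * E)
      ≈⟨ solve 5 (λ x a A Q E → (x :- (a :+ A)) :* ((x :- a) :* Q) :- (a :* (a :* Q) :+ (x :- a) :* E)
           := (x :- a) :* ((x :- A) :* Q :- E) :- x :* (a :* Q)) refl x a₀ A Q E ⟩
    (x - a₀) * ((x - A) * Q - E) - x * (a₀ * Q)
      ≈⟨ +-cong (*-congˡ (bordered-θ as x)) (-‿cong (*-congˡ (*-congˡ (sym (eval-∏ as x))))) ⟩
    (x - a₀) * (x * eval m (θ ∏[X- as ]) x) - x * (a₀ * eval m ∏[X- as ] x)
      ≈⟨ solve 4 (λ x a p q → (x :- a) :* (x :* p) :- x :* (a :* q) := x :* ((x :- a) :* p :- a :* q))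
           refl x a₀ (eval m (θ ∏[X- as ]) x) (eval m ∏[X- as ] x) ⟩
    x * ((x - a₀) * eval m (θ ∏[X- as ]) x - a₀ * eval m ∏[X- as ] x)
      ≈⟨ *-congˡ (eval-θ-[X-] m a₀ x (degree (∏-monic as))) ⟨
    x * eval (suc m) (θ ∏[X- a ]) x ∎
    where
    a₀ = a Fin.zero
    as = a ∘ Fin.suc
    y  = λ i → x - as i
    A  = sum as
    Q  = product y
    E  = sum (λ j → as j * borderMinor as y j)

  starLaplacian : ∀ {m} → Vector Carrier m → Matrix (suc m)
  starLaplacian a = bordered (sum a) (λ i → - a i) (λ i → - a i) a

  charPoly-star : ∀ {m} (a : Vector Carrier m) (A : Matrix (suc m)) → (∀ i j → A i j ≈ starLaplacian a i j) →
    ∀ x → charPoly A x ≈ x * eval m (θ ∏[X- a ]) x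
  charPoly-star {m} a A A≈ x = begin
    charPoly A x                                             ≈⟨ det-cong entries ⟩
    det (bordered (x - sum a) a a (λ i → x - a i))           ≈⟨ det-bordered (x - sum a) a a (λ i → x - a i) ⟩
    (x - sum a) * product (λ i → x - a i) - sum (λ j → a j * borderMinor a (λ i → x - a i) j) ≈⟨ bordered-θ a x ⟩
    x * eval m (θ ∏[X- a ]) x                                ∎
    where
    0-x : ∀ {n} (v : Vector Carrier n) i → 0# - - v i ≈ v i
    0-x v i = solve 1 (λ a → 𝟘 :- (:- a) := a) refl (v i)
    diagonal : ∀ {n} (v : Vector Carrier n) i j →
      (if does (i Fin.≟ j) then x else 0#) - diagonalMatrix v i j ≈ diagonalMatrix (λ i → x - v i) i j
    diagonal v Fin.zero    Fin.zero    = refl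
    diagonal v Fin.zero    (Fin.suc j) = -‿inverseʳ 0#
    diagonal v (Fin.suc i) Fin.zero    = -‿inverseʳ 0#
    diagonal v (Fin.suc i) (Fin.suc j) = diagonal (v ∘ Fin.suc) i j
    entries : ∀ i j → (if does (i Fin.≟ j) then x else 0#) - A i j ≈ bordered (x - sum a) a a (λ i → x - a i) i j
    entries i j = trans (+-congˡ (-‿cong (A≈ i j))) (go i j)
      where
      go : ∀ i j → (if does (i Fin.≟ j) then x else 0#) - starLaplacian a i j ≈ bordered (x - sum a) a a (λ i → x - a i) i j
      go Fin.zero    Fin.zero    = refl
      go Fin.zero    (Fin.suc j) = 0-x a j
      go (Fin.suc i) Fin.zero    = 0-x a i
      go (Fin.suc i) (Fin.suc j) = diagonal a i j

  sum-neg : ∀ {n} (v : Vector Carrier n) → sum (λ i → - v i) ≈ - sum v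
  sum-neg v = trans (sum-cong-≋ λ i → solve 1 (λ a → :- a := :- 𝟙 :* a) refl (v i))
    (trans (sum-scale (- 1#) v) (solve 1 (λ a → :- 𝟙 :* a := :- a) refl (sum v)))

  diagonalMatrix-diagonal : ∀ {n} (v : Vector Carrier n) i → diagonalMatrix v i i ≡ v i
  diagonalMatrix-diagonal v Fin.zero    = ≡.refl
  diagonalMatrix-diagonal v (Fin.suc i) = diagonalMatrix-diagonal (v ∘ Fin.suc) i

  diagonalMatrix-off : ∀ {n} (v : Vector Carrier n) i j → ¬ (i ≡ j) → diagonalMatrix v i j ≡ 0#
  diagonalMatrix-off v Fin.zero    Fin.zero    i≢j = ⊥-elim (i≢j ≡.refl)
  diagonalMatrix-off v Fin.zero    (Fin.suc j) i≢j = ≡.refl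
  diagonalMatrix-off v (Fin.suc i) Fin.zero    i≢j = ≡.refl
  diagonalMatrix-off v (Fin.suc i) (Fin.suc j) i≢j = diagonalMatrix-off (v ∘ Fin.suc) i j (i≢j ∘ ≡.cong Fin.suc)

  diagonalMatrix-sym : ∀ {n} (v : Vector Carrier n) i j → diagonalMatrix v i j ≡ diagonalMatrix v j i
  diagonalMatrix-sym v Fin.zero    Fin.zero    = ≡.refl
  diagonalMatrix-sym v Fin.zero    (Fin.suc j) = ≡.refl
  diagonalMatrix-sym v (Fin.suc i) Fin.zero    = ≡.refl
  diagonalMatrix-sym v (Fin.suc i) (Fin.suc j) = diagonalMatrix-sym (v ∘ Fin.suc) i j

  leaf-row : ∀ {n} i (v : Vector Carrier n) → (∀ k → ¬ (k ≡ i) → v k ≈ 0#) →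
    sum (λ k → if does (k Fin.≟ i) then 0# else v k) ≈ 0#
  leaf-row i v v≈0 = sum-≈0 go
    where
    go : ∀ k → (if does (k Fin.≟ i) then 0# else v k) ≈ 0#
    go k with k Fin.≟ i
    ... | yes _   = refl
    ... | no  k≢i = v≈0 k k≢i

  starLaplacian-S_L : ∀ {m} (a : Vector Carrier m) → (∀ i → 0# < a i) → S_L (star m) (starLaplacian a)
  starLaplacian-S_L a 0<a = record
    { symmetric = λ where
        Fin.zero    Fin.zero    → refl
        Fin.zero    (Fin.suc j) → refl
        (Fin.suc i) Fin.zero    → refl
        (Fin.suc i) (Fin.suc j) → reflexive (diagonalMatrix-sym a i j)
    ; edge = λ where
        Fin.zero    Fin.zero    (inj₁ (_ , 0≢0)) → ⊥-elim (0≢0 ≡.refl)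
        Fin.zero    Fin.zero    (inj₂ (_ , 0≢0)) → ⊥-elim (0≢0 ≡.refl)
        Fin.zero    (Fin.suc j) _ → -‿neg (0<a j)
        (Fin.suc i) Fin.zero    _ → -‿neg (0<a i)
        (Fin.suc i) (Fin.suc j) (inj₁ (() , _))
        (Fin.suc i) (Fin.suc j) (inj₂ (() , _))
    ; nonEdge = λ where
        Fin.zero    Fin.zero    0≢0 _ → ⊥-elim (0≢0 ≡.refl)
        Fin.zero    (Fin.suc j) _ ¬adj → ⊥-elim (¬adj (inj₁ (≡.refl , λ ())))
        (Fin.suc i) Fin.zero    _ ¬adj → ⊥-elim (¬adj (inj₂ (≡.refl , λ ())))
        (Fin.suc i) (Fin.suc j) i≢j _ → reflexive (diagonalMatrix-off a i j (i≢j ∘ ≡.cong Fin.suc))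
    ; diagonal = λ where
        Fin.zero    → trans (solve 1 (λ s → s := :- (𝟘 :+ :- s))
              refl (sum a)) (-‿cong (+-congˡ (sym (sum-neg a))))
        (Fin.suc i) → trans (reflexive (diagonalMatrix-diagonal a i))
          (trans (solve 1 (λ s → s := :- (:- s :+ 𝟘)) refl (a i))
            (-‿cong (+-congˡ (sym (leaf-row i (diagonalMatrix a i) λ k k≢i →
              reflexive (diagonalMatrix-off a i k (k≢i ∘ ≡.sym)))))))
    }

  -- The row of the centre determines the matrix: symmetry gives the first column, leaves are
  -- pairwise nonadjacent, and the zero row sums fix the diagonal.
  star-weights : ∀ {m} (A : Matrix (suc m)) → S_L (star m) A →
    ∃ λ (a : Vector Carrier m) → (∀ i → 0# < a i) × (∀ i j → A i j ≈ starLaplacian a i j)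
  star-weights {m} A A∈S = a , (λ i → -‿pos (edge Fin.zero (Fin.suc i) (inj₁ (≡.refl , λ ())))) , entries
    where
    open S_L A∈S
    a : Vector Carrier m
    a i = - A Fin.zero (Fin.suc i)
    leaf : ∀ i j → ¬ (i ≡ j) → A (Fin.suc i) (Fin.suc j) ≈ 0#
    leaf i j i≢j = nonEdge (Fin.suc i) (Fin.suc j) (i≢j ∘ Fin.suc-injective) λ { (inj₁ (() , _)) ; (inj₂ (() , _)) }
    0-row : ∀ i → A Fin.zero (Fin.suc i) ≈ - a i
    0-row i = solve 1 (λ x → x := :- (:- x)) refl _
    entries : ∀ i j → A i j ≈ starLaplacian a i j
    entries Fin.zero    Fin.zero    = trans (diagonal Fin.zero)
      (trans (-‿cong (+-identityˡ _)) (sym (sum-neg (λ i → A Fin.zero (Fin.suc i)))))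
    entries Fin.zero    (Fin.suc j) = 0-row j
    entries (Fin.suc i) Fin.zero    = trans (symmetric (Fin.suc i) Fin.zero) (0-row i)
    entries (Fin.suc i) (Fin.suc j) with i Fin.≟ j
    ... | no  i≢j    = trans (leaf i j i≢j) (reflexive (≡.sym (diagonalMatrix-off a i j i≢j)))
    ... | yes ≡.refl = trans (diagonal (Fin.suc i)) (trans
      (-‿cong (trans (+-cong (symmetric (Fin.suc i) Fin.zero)
        (leaf-row i (λ k → A (Fin.suc i) (Fin.suc k)) λ k k≢i → leaf i k (k≢i ∘ ≡.sym)))
                     (+-identityʳ _)))
      (reflexive (≡.sym (diagonalMatrix-diagonal a i))))

  -- Realizability

  -- Both forms of the characteristic polynomial carry a factor `x`, which cancels away from `0`;
  -- that suffices for `identity-theorem`.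
  realizable⇒∏≐θ∏ : ∀ {m} (v : Vector Carrier m) → LaplacianRealizable (star m) (0# Vector.∷ v) →
    ∃ λ (a : Vector Carrier m) → (∀ i → 0# < a i) × ∏[X- v ] ≐ θ ∏[X- a ]
  realizable⇒∏≐θ∏ {m} v (A , A∈S , spectrum) =
    let a , 0<a , A≈ = star-weights A A∈S in
    a , 0<a , identity-theorem m (degree (∏-monic v)) (θ-degree (degree (∏-monic a))) λ x x≉0 →
      *-cancelˡ x≉0 (begin
        x * eval m ∏[X- v ] x                   ≈⟨ *-cong (solve 1 (λ x → x := x :- 𝟘) refl x) (eval-∏ v x) ⟩
        product (λ i → x - (0# Vector.∷ v) i)   ≈⟨ spectrum x ⟨
        charPoly A x                            ≈⟨ charPoly-star a A A≈ x ⟩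
        x * eval m (θ ∏[X- a ]) x               ∎)

  ∏≐θ∏⇒realizable : ∀ {m} (v a : Vector Carrier m) → (∀ i → 0# < a i) → ∏[X- v ] ≐ θ ∏[X- a ] →
    LaplacianRealizable (star m) (0# Vector.∷ v)
  ∏≐θ∏⇒realizable {m} v a 0<a P≐θQ = starLaplacian a , starLaplacian-S_L a 0<a , λ x → begin
    charPoly (starLaplacian a) x            ≈⟨ charPoly-star a (starLaplacian a) (λ _ _ → refl) x ⟩
    x * eval m (θ ∏[X- a ]) x               ≈⟨ *-cong (solve 1 (λ x → x := x :- 𝟘)
          refl x) (sym (eval-cong m P≐θQ refl)) ⟩
    (x - 0#) * eval m ∏[X- v ] x            ≈⟨ *-congˡ (eval-∏ v x) ⟩
    product (λ i → x - (0# Vector.∷ v) i)   ∎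

  realizable⇒signs : ∀ {m} (v : Vector Carrier (suc m)) → Nondecreasing v →
    LaplacianRealizable (star (suc m)) (0# Vector.∷ v) → SignCondition v
  realizable⇒signs {m} v mono realizable i _ = 0≤-x⇒x≤0 (0≤-resp (begin
    sgn (after i) * eval (suc m) ∏[X- a ] (v i)             ≈⟨ *-congˡ (eval-cong (suc m) Q≐θ⁻¹P refl) ⟩
    sgn (after i) * eval (suc m) (θ⁻¹ ∏[X- v ]) (v i)       ≈⟨ solve 1 (λ x → x := :- (:- x)) refl _ ⟩
    - - (sgn (after i) * eval (suc m) (θ⁻¹ ∏[X- v ]) (v i)) ≈⟨ -‿cong (sgn-f v i) ⟨
    - (sgn (2 ℕ.+ toℕ i) * f v (- v i))                     ∎)
    (interlacing-signs v a mono (proj₁ (proj₂ weights)) P≐θQ i))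
    where
    weights : ∃ λ (a : Vector Carrier (suc m)) → (∀ i → 0# < a i) × ∏[X- v ] ≐ θ ∏[X- a ]
    weights = realizable⇒∏≐θ∏ v realizable
    a : Vector Carrier (suc m)
    a = proj₁ weights
    P≐θQ : ∏[X- v ] ≐ θ ∏[X- a ]
    P≐θQ = proj₂ (proj₂ weights)
    Q≐θ⁻¹P : ∏[X- a ] ≐ θ⁻¹ ∏[X- v ]
    Q≐θ⁻¹P = θ-injective (≐-trans (≐-sym P≐θQ) (≐-sym (θ-θ⁻¹ ∏[X- v ])))

  signs⇒realizable : ∀ {m} (v : Vector Carrier (suc m)) → 0# < v Fin.zero → Nondecreasing v →
    SignCondition v → LaplacianRealizable (star (suc m)) (0# Vector.∷ v)
  signs⇒realizable {m} v 0<v₀ mono signs = ∏≐θ∏⇒realizable v (proj₁ factors) (proj₁ (proj₂ factors))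
    (≐-trans (≐-sym (θ-θ⁻¹ P)) (θ-cong (proj₂ (proj₂ factors))))
    where
    P Q : Coefficients
    P = ∏[X- v ]
    Q = θ⁻¹ P
    0<v : ∀ i → 0# < v i
    0<v i = <-≤-trans 0<v₀ (mono Fin.zero i ℕ.z≤n)
    -- At `0` only the constant coefficient counts, and `θ⁻¹` divides it by `m + 2`, so `Q(0)` has
    -- the sign of `P(0)`.
    sign-0 : 0# < sgn (suc m) * eval (suc m) Q 0#
    sign-0 = <-respʳ (begin
      sgn (suc m) * eval (suc m) P 0# * n ⁻¹
        ≈⟨ solve 4 (λ s a e i → s :* (a :+ 𝟘 :* e) :* i := s :* (a :* i))
              refl (sgn (suc m)) (P (suc m)) (eval m P 0#) (n ⁻¹) ⟩
      sgn (suc m) * Q (suc m)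
        ≈⟨ solve 3 (λ s a e → s :* a := s :* (a :+ 𝟘 :* e)) refl (sgn (suc m)) (Q (suc m)) (eval m Q 0#) ⟩
      sgn (suc m) * eval (suc m) Q 0# ∎) (*-pos (eval-∏-strictly-below v 0# 0<v) (⁻¹-pos (suc·1-pos (suc m))))
      where n = suc (suc m) · 1#
    last-sign : ∀ i → (∀ j → v j ≤ v i) → 0# ≤ eval (suc m) Q (v i)
    last-sign i v≤vᵢ = means-∏ (0<v i) v (inj₁ ∘ 0<v) v≤vᵢ 0
    signs′ : ∀ i → 0# ≤ sgn (after i) * eval (suc m) Q (v i)
    signs′ i with suc (suc (toℕ i)) ℕ.≤? suc m
    ... | yes 2+i≤1+m = 0≤-resp (begin
      - (sgn (2 ℕ.+ toℕ i) * f v (- v i))              ≈⟨ -‿cong (sgn-f v i) ⟩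
      - - (sgn (after i) * eval (suc m) Q (v i))       ≈⟨ solve 1 (λ x → :- (:- x) := x) refl _ ⟩
      sgn (after i) * eval (suc m) Q (v i)             ∎) (x≤0⇒0≤-x (signs i 2+i≤1+m))
    -- The last index, on which the sign condition is silent: `after i` is `0` and `v i` is the
    -- largest root of `P`.
    ... | no  2+i≰1+m = 0≤-resp (sym (trans (*-congʳ (reflexive (≡.cong sgn (after-last i m≤i)))) (*-identityˡ _)))
      (last-sign i λ j → mono j i (ℕ.≤-trans (ℕ.≤-pred (Fin.toℕ<n j)) m≤i))
      where
      m≤i : m ℕ.≤ toℕ i
      m≤i = ℕ.≤-pred (ℕ.≤-pred (ℕ.≰⇒> 2+i≰1+m))
      after-last : ∀ {n} (i : Fin (suc n)) → n ℕ.≤ toℕ i → after i ≡ 0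
      after-last {zero}  Fin.zero    _         = ≡.refl
      after-last {suc n} (Fin.suc i) (ℕ.s≤s n≤i) = after-last i n≤i
    inherits : InheritsMultiplicities 0# (suc m) P Q
    inherits t 0<t k mult root = mult-θ k (suc m) 0<t (∏-monic v) (θ⁻¹-monic (∏-monic v)) (≐-sym (θ-θ⁻¹ P)) root mult
    factors : ∃ λ (a : Vector Carrier (suc m)) → (∀ i → 0# < a i) × Q ≐ ∏[X- a ]
    factors = splits (suc m) 0# v Q (θ⁻¹-monic (∏-monic v)) mono 0<v sign-0 signs′ inherits

open import Data.Nat.Base using (_+_; _∸_)
open import Data.Vec.Functional using (_∷_)

theorem2p6 : ∀ {c ℓ₁ ℓ₂} (ℝ : Reals c ℓ₁ ℓ₂) (p : ℕ) → let n = 2 + p in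
    (λs : Vector (Reals.Carrier ℝ) (n ∸ 1)) →
    OverReals.PositiveNondecreasing ℝ λs →
    OverReals.LaplacianRealizable ℝ (star (n ∸ 1)) (Reals.0# ℝ ∷ λs) ⇔ OverReals.SignCondition ℝ λs
theorem2p6 ℝ p λs (0<λ₂ , mono) = mk⇔
  (StarSpectra.realizable⇒signs ℝ λs mono) (StarSpectra.signs⇒realizable ℝ λs 0<λ₂ mono)
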